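{- Let $k$ be a positive integer and let $T$ be a string of length $n$. The total number of $k$-runs in $T$ (over all periods $\ell\in[1\mathinner{.\,.}\lfloor n/2\rfloor]$) is $\mathcal{O}(nk\log k)$.
   Context: Positions of a string $T$ are numbered $1,\dots,|T|$; $T[i\mathinner{.\,.} j]=T[i\mathinner{.\,.} j+1)$ denotes the substring $T[i]T[i+1]\cdots T[j]$, and $[i\mathinner{.\,.} j]=[i\mathinner{.\,.} j+1)=\{i,\dots,j\}$. For equal-length strings $X,Y$, the Hamming distance is $d_H(X,Y)=|\{i: X[i]\ne Y[i]\}|$. A $k$-mismatch square is a string $XY$ with $|X|=|Y|$ and $d_H(X,Y)\le k$. A $k$-run of period $\ell$ in $T$ is a substring $T[a\mathinner{.\,.} b)$ with $b-a\ge 2\ell$ such that $T[i\mathinner{.\,.} i+2\ell)$ is a $k$-mismatch square for every $i\in[a\mathinner{.\,.} b-2\ell]$, and which is maximal, i.e., it cannot be extended to the left or to the right while still satisfying this property for the same $\ell$. A $k$-run is identified by the triple $(a,b,\ell)$.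
   Formalization: The factor log k is read as 1+⌊log₂ k⌋, because at k = 1 the literal bound would be 0 although 1-runs exist (e.g. in "aa"); for k ≥ 2 this differs from log k only by a constant factor. -}

module Defs where

open import Data.Nat using (ℕ; zero; suc; _+_; _*_; _∸_; _≤_)
open import Data.List using (List; []; _∷_; take; drop; length; _++_)
open import Data.Product using (_×_; ∃-syntax; _,_)
open import Relation.Binary.Definitions using (DecidableEquality)
open import Relation.Binary.PropositionalEquality using (_≡_)
open import Relation.Nullary using (yes; no)

-- Hamming distance of two lists (only used on equal-length lists)
dH : {A : Set} → DecidableEquality A → List A → List A → ℕ
dH _≟_ (x ∷ xs) (y ∷ ys) with x ≟ y
... | yes _ = dH _≟_ xs ys
... | no  _ = suc (dH _≟_ xs ys)
dH _≟_ _ _ = 0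

-- T[i .. j) with 1-based positions
sub : {A : Set} → List A → ℕ → ℕ → List A
sub T i j = take (j ∸ i) (drop (i ∸ 1) T)

IsKSquare : {A : Set} → DecidableEquality A → ℕ → List A → Set
IsKSquare _≟_ k S =
  ∃[ X ] ∃[ Y ] (S ≡ X ++ Y × length X ≡ length Y × dH _≟_ X Y ≤ k)

KSquareRange : {A : Set} → DecidableEquality A → ℕ → List A → ℕ → ℕ → ℕ → Set
KSquareRange _≟_ k T a b ℓ =
  1 ≤ a × b ≤ suc (length T) × 1 ≤ ℓ × a + 2 * ℓ ≤ b ×
  (∀ i → a ≤ i → i + 2 * ℓ ≤ b → IsKSquare _≟_ k (sub T i (i + 2 * ℓ)))

IsKRun : {A : Set} → DecidableEquality A → ℕ → List A → ℕ × ℕ × ℕ → Set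
IsKRun _≟_ k T (a , b , ℓ) =
  KSquareRange _≟_ k T a b ℓ ×
  (∀ a' b' → a' ≤ a → b ≤ b' → KSquareRange _≟_ k T a' b' ℓ → a' ≡ a × b' ≡ b)

{-# OPTIONS --safe #-}

-- For a fixed period ℓ let D be the set of positions i with T[i] ≠ T[i + ℓ].  A k-run that does
-- not start at the first position starts right after some b ∈ D whose window [b , b + ℓ) meets D
-- in at most k + 1 points; call (b , ℓ) a start.  It suffices to count starts with ℓ ≥ 4(k + 1).
-- The points of D cut the window of a start into at most k + 1 gaps covering most of it, so the
-- gaps of length at least ℓ / O(k) have total length Ω(ℓ).  Charge the start to those gaps in
-- proportion to their length.  Every gap lies in the windows of at most k + 1 starts, and there
-- are O(αn) gaps of length at least ℓ / α, so each of the O(log k) dyadic values of α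
-- contributes O(nk).
--
-- The bound O(αn) on such gaps (maximal α-gapped repeats) is proved scale by scale, ℓ ≈ 4ασ.  If
-- the agreeing block contains no short period in its middle, it has only O(α) copies at distance
-- about 4ασ, and each gap can be charged to σ positions.  Otherwise, by maximality, a short
-- period p breaks to the left near the gap or near its copy, at a run start; a run start has
-- O(ασ / p) such copies, and σ / p summed over all run starts and scales is O(n), since by
-- (one step of) the Fine–Wilf theorem runs with comparable periods hardly overlap.
module Submission where

open import Defs
open import Data.Empty using (⊥-elim)
open import Data.List using (List; []; _∷_; _++_; drop; length; map; take)
open import Data.List.Properties using (length-++; length-drop; length-map; length-take; take++drop≡id)
open import Data.List.Relation.Unary.All as All using (All)
import Data.List.Relation.Unary.All.Properties as All
open import Data.List.Relation.Unary.AllPairs as AllPairs using (AllPairs)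
import Data.List.Relation.Unary.AllPairs.Properties as AllPairs
open import Data.List.Relation.Unary.Unique.Propositional using (Unique)
open import Data.Maybe using (Maybe; just; nothing)
open import Data.Maybe.Properties using (≡-dec)
open import Data.Nat
open import Data.Nat.Logarithm using (⌊log₂_⌋; ⌊log₂⌋-mono-≤; ⌊log₂[2^n]⌋≡n)
open import Data.Nat.Properties renaming (_≟_ to _≟ℕ_)
open import Data.Nat.Tactic.RingSolver using (solve; solve-∀)
open import Data.Product using (_×_; ∃-syntax; _,_; proj₁; proj₂)
open import Data.Sum using (_⊎_; inj₁; inj₂)
open import Function using (_∘_)
open import Relation.Binary.Definitions using (DecidableEquality; tri<; tri≈; tri>)
open import Relation.Binary.PropositionalEquality using (_≡_; _≢_; refl; sym; trans; cong; cong₂; subst; module ≡-Reasoning)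
open import Relation.Nullary using (Dec; yes; no; ¬_; ¬?; _×-dec_; _→-dec_)
open import Relation.Nullary.Decidable using (map′)

-- Linear arithmetic by certificate: a ≤ b follows from the combination L ≤ R of the
-- hypotheses as soon as b − a exceeds R − L by the explicit natural number k.
linear : ∀ {a b L R} k → L ≤ R → a + R + k ≡ b + L → a ≤ b
linear {a} {b} {L} {R} k L≤R eq = +-cancelʳ-≤ R a b (begin
  a + R     ≤⟨ m≤m+n (a + R) k ⟩
  a + R + k ≡⟨ eq ⟩
  b + L     ≤⟨ +-monoʳ-≤ b L≤R ⟩
  b + R     ∎)
  where open ≤-Reasoning

infixr 5 _⊞_
_⊞_ : ∀ {a b c d} → a ≤ b → c ≤ d → a + c ≤ b + d
_⊞_ = +-mono-≤

infixr 6 _⊠_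
_⊠_ : ∀ c {a b} → a ≤ b → c * a ≤ c * b
c ⊠ a≤b = *-monoʳ-≤ c a≤b

-- Finite sums and indicator functions

∑ : ℕ → (ℕ → ℕ) → ℕ
∑ zero    f = 0
∑ (suc n) f = f 0 + ∑ n (λ i → f (suc i))

∑-mono : ∀ n {f g} → (∀ i → i < n → f i ≤ g i) → ∑ n f ≤ ∑ n g
∑-mono zero    f≤g = z≤n
∑-mono (suc n) f≤g = f≤g 0 z<s ⊞ ∑-mono n (λ i i<n → f≤g (suc i) (s<s i<n))

∑-cong : ∀ n {f g} → (∀ i → i < n → f i ≡ g i) → ∑ n f ≡ ∑ n g
∑-cong zero    f≡g = refl
∑-cong (suc n) f≡g = cong₂ _+_ (f≡g 0 z<s) (∑-cong n (λ i i<n → f≡g (suc i) (s<s i<n)))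

∑-distrib-+ : ∀ n f g → ∑ n (λ i → f i + g i) ≡ ∑ n f + ∑ n g
∑-distrib-+ zero    f g = refl
∑-distrib-+ (suc n) f g = trans
  (cong (f 0 + g 0 +_) (∑-distrib-+ n (f ∘ suc) (g ∘ suc)))
  (interchange (f 0) (g 0) (∑ n (f ∘ suc)) (∑ n (g ∘ suc)))
  where
  interchange : ∀ a b c d → a + b + (c + d) ≡ a + c + (b + d)
  interchange = solve-∀

*-distribˡ-∑ : ∀ c n f → c * ∑ n f ≡ ∑ n (λ i → c * f i)
*-distribˡ-∑ c zero    f = *-zeroʳ c
*-distribˡ-∑ c (suc n) f =
  trans (*-distribˡ-+ c (f 0) _) (cong (c * f 0 +_) (*-distribˡ-∑ c n (f ∘ suc)))

*-distribʳ-∑ : ∀ c n f → ∑ n f * c ≡ ∑ n (λ i → f i * c)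
*-distribʳ-∑ c zero    f = refl
*-distribʳ-∑ c (suc n) f =
  trans (*-distribʳ-+ c (f 0) _) (cong (f 0 * c +_) (*-distribʳ-∑ c n (f ∘ suc)))

∑-zero : ∀ n → ∑ n (λ _ → 0) ≡ 0
∑-zero zero    = refl
∑-zero (suc n) = ∑-zero n

∑-swap : ∀ m n (f : ℕ → ℕ → ℕ) → ∑ m (λ i → ∑ n (f i)) ≡ ∑ n (λ j → ∑ m (λ i → f i j))
∑-swap zero    n f = sym (∑-zero n)
∑-swap (suc m) n f = trans
  (cong (∑ n (f 0) +_) (∑-swap m n (f ∘ suc)))
  (sym (∑-distrib-+ n (f 0) (λ j → ∑ m (λ i → f (suc i) j))))

∑₃ : ℕ → ℕ → ℕ → (ℕ → ℕ → ℕ → ℕ) → ℕ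
∑₃ a b c f = ∑ a (λ u → ∑ b (λ v → ∑ c (f u v)))

∑-∑₃-swap : ∀ m a b c (f : ℕ → ℕ → ℕ → ℕ → ℕ) →
  ∑ m (λ i → ∑₃ a b c (f i)) ≡ ∑₃ a b c (λ u v w → ∑ m (λ i → f i u v w))
∑-∑₃-swap m a b c f = trans (∑-swap m a _) (∑-cong a λ u _ →
  trans (∑-swap m b _) (∑-cong b λ v _ → ∑-swap m c _))

∑₃-mono : ∀ a b c {f g} → (∀ u v w → f u v w ≤ g u v w) → ∑₃ a b c f ≤ ∑₃ a b c g
∑₃-mono a b c h = ∑-mono a λ u _ → ∑-mono b λ v _ → ∑-mono c λ w _ → h u v w

*-distribˡ-∑₃ : ∀ m a b c f → m * ∑₃ a b c f ≡ ∑₃ a b c (λ u v w → m * f u v w)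
*-distribˡ-∑₃ m a b c f = trans (*-distribˡ-∑ m a _) (∑-cong a λ u _ →
  trans (*-distribˡ-∑ m b _) (∑-cong b λ v _ → *-distribˡ-∑ m c _))

∑-bounded : ∀ n {f} c → (∀ i → i < n → f i ≤ c) → ∑ n f ≤ n * c
∑-bounded zero    c f≤c = z≤n
∑-bounded (suc n) c f≤c = f≤c 0 z<s ⊞ ∑-bounded n c (λ i i<n → f≤c (suc i) (s<s i<n))

∑-last : ∀ n f → ∑ (suc n) f ≡ ∑ n f + f n
∑-last zero    f = +-identityʳ (f 0)
∑-last (suc n) f =
  trans (cong (f 0 +_) (∑-last n (f ∘ suc))) (sym (+-assoc (f 0) _ (f (suc n))))

∑-term : ∀ {n i} f → i < n → f i ≤ ∑ n f
∑-term {suc n} {zero}  f i<n       = m≤m+n (f 0) _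
∑-term {suc n} {suc i} f (s≤s i<n) = ≤-trans (∑-term (f ∘ suc) i<n) (m≤n+m _ (f 0))

∑-interval : ∀ a c {n} f → a + c ≤ n → ∑ c (λ o → f (a + o)) ≤ ∑ n f
∑-interval zero    zero    f h       = z≤n
∑-interval zero    (suc c) f (s≤s h) = +-monoʳ-≤ (f 0) (∑-interval 0 c (f ∘ suc) h)
∑-interval (suc a) c       f (s≤s h) = ≤-trans (∑-interval a c (f ∘ suc) h) (m≤n+m _ (f 0))

∑-ones : ∀ n → ∑ n (λ _ → 1) ≡ n
∑-ones zero    = refl
∑-ones (suc n) = cong suc (∑-ones n)

∑₃-term : ∀ {a b c u v w} f → u < a → v < b → w < c → f u v w ≤ ∑₃ a b c f
∑₃-term {a} {b} {c} {u} {v} f u<a v<b w<c = ≤-trans (∑-term (f u v) w<c)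
  (≤-trans (∑-term (λ v → ∑ c (f u v)) v<b) (∑-term (λ u → ∑ b (λ v → ∑ c (f u v))) u<a))

length≤∑ : ∀ a c {n} f → a + c ≤ n → (∀ o → o < c → 1 ≤ f (a + o)) → c ≤ ∑ n f
length≤∑ a c {n} f h pos = begin
  c                      ≡⟨ sym (∑-ones c) ⟩
  ∑ c (λ _ → 1)          ≤⟨ ∑-mono c pos ⟩
  ∑ c (λ o → f (a + o))  ≤⟨ ∑-interval a c f h ⟩
  ∑ n f                  ∎
  where open ≤-Reasoning

∑-positive : ∀ n f → 1 ≤ ∑ n f → ∃[ i ] (i < n × 1 ≤ f i)
∑-positive (suc n) f h with f 0 in eq
... | suc m = 0 , z<s , subst (1 ≤_) (sym eq) z<s
... | zero  with ∑-positive n (f ∘ suc) h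
...   | i , i<n , pos = suc i , s<s i<n , pos

≡0⊎positive : ∀ m → m ≡ 0 ⊎ 1 ≤ m
≡0⊎positive zero    = inj₁ refl
≡0⊎positive (suc m) = inj₂ z<s

∑≤1 : ∀ n f → (∀ i → f i ≤ 1) → (∀ i j → 1 ≤ f i → 1 ≤ f j → i ≡ j) → ∑ n f ≤ 1
∑≤1 zero    f small single = z≤n
∑≤1 (suc n) f small single with ≡0⊎positive (∑ n (f ∘ suc))
... | inj₁ eq rewrite eq = subst (_≤ 1) (sym (+-identityʳ (f 0))) (small 0)
... | inj₂ pos with ∑-positive n (f ∘ suc) pos | ≡0⊎positive (f 0)
...   | i , _ , fi | inj₂ f0 with single 0 (suc i) f0 fi
...     | ()
∑≤1 (suc n) f small single | inj₂ pos | _ | inj₁ eq rewrite eq =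
  ∑≤1 n (f ∘ suc) (λ i → small (suc i)) (λ i j p q → suc-injective (single (suc i) (suc j) p q))

∑-truncate : ∀ n m {f g} → (∀ i → i < m → f i ≤ g i) → (∀ i → 1 ≤ f i → i < m) → ∑ n f ≤ ∑ m g
∑-truncate zero    m       f≤g support = z≤n
∑-truncate (suc n) (suc m) f≤g support =
  f≤g 0 z<s ⊞
  ∑-truncate n m (λ i i<m → f≤g (suc i) (s<s i<m)) (λ i pos → s<s⁻¹ (support (suc i) pos))
∑-truncate (suc n) zero {f} f≤g support with ≡0⊎positive (∑ (suc n) f)
... | inj₁ eq  = ≤-reflexive eq
... | inj₂ pos with ∑-positive (suc n) f pos
...   | i , _ , fi with support i fi
...     | ()

∑-restrict : ∀ lo n len {f} → (∀ i → 1 ≤ f i → lo ≤ i × i < lo + len) →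
  ∑ n f ≤ ∑ len (λ i → f (lo + i))
∑-restrict zero     n       len support =
  ∑-truncate n len (λ _ _ → ≤-refl) (λ i pos → proj₂ (support i pos))
∑-restrict (suc lo) zero    len support = z≤n
∑-restrict (suc lo) (suc n) len {f} support with ≡0⊎positive (f 0)
... | inj₂ pos with support 0 pos
...   | () , _
∑-restrict (suc lo) (suc n) len {f} support | inj₁ eq rewrite eq =
  ∑-restrict lo n len λ i pos →
    let lo≤i , i<hi = support (suc i) pos in s≤s⁻¹ lo≤i , s<s⁻¹ i<hi

χ : {P : Set} → Dec P → ℕ
χ (yes _) = 1
χ (no  _) = 0

χ≤1 : {P : Set} (P? : Dec P) → χ P? ≤ 1
χ≤1 (yes _) = ≤-refl
χ≤1 (no  _) = z≤n

χ-holds : {P : Set} {P? : Dec P} → 1 ≤ χ P? → P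
χ-holds {P? = yes p} _ = p

c*0≤ : ∀ c {m} → c * 0 ≤ m
c*0≤ c = ≤-trans (≤-reflexive (*-zeroʳ c)) z≤n

*χ≤ : {P : Set} (c : ℕ) {m : ℕ} (P? : Dec P) → (P → c ≤ m) → c * χ P? ≤ m
*χ≤ c (yes p) h = subst (_≤ _) (sym (*-identityʳ c)) (h p)
*χ≤ c (no  _) h = c*0≤ c

χ≤ : {P : Set} {m : ℕ} (P? : Dec P) → (P → 1 ≤ m) → χ P? ≤ m
χ≤ (yes p) h = h p
χ≤ (no  _) h = z≤n

χ≥1 : {P : Set} (P? : Dec P) → P → 1 ≤ χ P?
χ≥1 (yes _) p = ≤-refl
χ≥1 (no ¬p) p = ⊥-elim (¬p p)

-- Counting elements of a spaced set.

Spaced : ℕ → ℕ → (ℕ → Set) → Set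
Spaced σ K P = ∀ i d → P i → P (i + suc d) → σ ≤ K * suc d

module _ (σ K : ℕ) where

  -- Here suc g is the distance from 0 back to the previous element.
  spaced-tail : ∀ n g {P : ℕ → Set} (P? : ∀ i → Dec (P i)) → Spaced σ K P →
    (∀ i → P i → σ ≤ K * (suc g + i)) → σ * ∑ n (λ i → χ (P? i)) ≤ K * (g + n)
  spaced-tail zero    g P? spaced far = c*0≤ σ
  spaced-tail (suc n) g P? spaced far with P? 0
  ... | yes p = linear 0
        (far 0 p ⊞ spaced-tail n 0 (P? ∘ suc) (spaced ∘ suc) (λ i → spaced 0 i p))
        (identity σ K g n (∑ n (λ i → χ (P? (suc i)))))
    where
    identity : ∀ σ K g n S →
      σ * (1 + S) + (K * (suc g + 0) + K * (0 + n)) + 0 ≡ K * (g + suc n) + (σ + σ * S)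
    identity = solve-∀
  ... | no  _ = ≤-trans
    (spaced-tail n (suc g) (P? ∘ suc) (spaced ∘ suc)
      (λ i p → subst (λ m → σ ≤ K * suc m) (+-suc g i) (far (suc i) p)))
    (≤-reflexive (cong (K *_) (sym (+-suc g n))))

  -- The first element accounts for the summand `σ`; each later one is paid for by its distance to
  -- its predecessor, and these distances add up to less than `n`.
  spaced-prefix : ∀ n {P : ℕ → Set} (P? : ∀ i → Dec (P i)) → Spaced σ K P →
    σ * ∑ n (λ i → χ (P? i)) ≤ K * n + σ
  spaced-prefix zero    P? spaced = c*0≤ σ
  spaced-prefix (suc n) P? spaced with P? 0
  ... | yes p = linear K
        (spaced-tail n 0 (P? ∘ suc) (spaced ∘ suc) (λ i → spaced 0 i p))
        (identity σ K n (∑ n (λ i → χ (P? (suc i)))))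
    where
    identity : ∀ σ K n S → σ * (1 + S) + K * (0 + n) + K ≡ K * suc n + σ + σ * S
    identity = solve-∀
  ... | no  _ = ≤-trans (spaced-prefix n (P? ∘ suc) (spaced ∘ suc))
                        (+-monoˡ-≤ σ (*-monoʳ-≤ K (n≤1+n n)))

  spaced-count : ∀ lo n len {P : ℕ → Set} (P? : ∀ i → Dec (P i)) → Spaced σ K P →
    (∀ i → P i → lo ≤ i × i < lo + len) → σ * ∑ n (λ i → χ (P? i)) ≤ K * len + σ
  spaced-count lo n len {P} P? spaced range = ≤-trans
    (*-monoʳ-≤ σ (∑-restrict lo n len (λ i pos → range i (χ-holds pos))))
    (spaced-prefix len (λ i → P? (lo + i))
      (λ i d p q → spaced (lo + i) d p (subst P (sym (+-assoc lo i (suc d))) q)))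

-- Bounded search and dyadic scales.

all-in? : ∀ {P : ℕ → Set} → (∀ i → Dec (P i)) → ∀ x y → Dec (∀ i → x ≤ i → i < y → P i)
all-in? P? x y = map′ (λ h i x≤i i<y → h i<y x≤i) (λ h {i} i<y x≤i → h i x≤i i<y)
  (allUpTo? (λ i → (x ≤? i) →-dec P? i) y)

least : ∀ {P : ℕ → Set} → (∀ i → Dec (P i)) → ∀ n →
  (∃[ i ] (i < n × P i × (∀ j → j < i → ¬ P j))) ⊎ (∀ i → i < n → ¬ P i)
least P? zero = inj₂ λ _ ()
least P? (suc n) with least P? n
... | inj₁ (i , i<n , rest) = inj₁ (i , m<n⇒m<1+n i<n , rest)
... | inj₂ none with P? n
...   | yes p = inj₁ (n , n<1+n n , p , none)
...   | no ¬p = inj₂ λ i i<1+n p → case-last i (m≤n⇒m<n∨m≡n (s≤s⁻¹ i<1+n)) p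
  where
  case-last : ∀ i → i < n ⊎ i ≡ n → _ → _
  case-last i (inj₁ i<n)  p = none i i<n p
  case-last i (inj₂ refl) p = ¬p p

n<2^n : ∀ n → n < 2 ^ n
n<2^n zero    = ≤-refl
n<2^n (suc n) = linear 0 (n<2^n n ⊞ ≤-trans (s≤s z≤n) (n<2^n n)) (identity n (2 ^ n))
  where
  identity : ∀ n w → suc (suc n) + (w + w) + 0 ≡ 2 * w + (suc n + 1)
  identity = solve-∀

dyadic : ∀ c m → 1 ≤ c → c ≤ m → ∃[ i ] (c * 2 ^ i ≤ m × m < 2 * (c * 2 ^ i))
dyadic c m 1≤c c≤m with least (λ i → m <? 2 * (c * 2 ^ i)) (suc m)
-- The search bound `suc m` suffices because `m < 2 ^ m`.
... | inj₂ none = ⊥-elim (none m (n<1+n m) (begin-strict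
  m                <⟨ n<2^n m ⟩
  2 ^ m            ≡⟨ sym (*-identityˡ (2 ^ m)) ⟩
  1 * 2 ^ m        ≤⟨ *-monoˡ-≤ (2 ^ m) 1≤c ⟩
  c * 2 ^ m        ≤⟨ m≤m+n (c * 2 ^ m) _ ⟩
  2 * (c * 2 ^ m)  ∎))
  where open ≤-Reasoning
... | inj₁ (zero  , _ , small , _)   = 0 , ≤-trans (≤-reflexive (*-identityʳ c)) c≤m , small
... | inj₁ (suc i , _ , small , min) =
  suc i , ≤-trans (≤-reflexive (double c (2 ^ i))) (≮⇒≥ (min i (n<1+n i))) , small
  where
  double : ∀ c w → c * (2 * w) ≡ 2 * (c * w)
  double = solve-∀

∑₃≤1 : ∀ a b c (f : ℕ → ℕ → ℕ → ℕ) → (∀ i j k → f i j k ≤ 1) →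
  (∀ i j k i′ j′ k′ → 1 ≤ f i j k → 1 ≤ f i′ j′ k′ → i ≡ i′ × j ≡ j′ × k ≡ k′) →
  ∑₃ a b c f ≤ 1
∑₃≤1 a b c f small single =
  ∑≤1 a _ (λ i → ∑≤1 b _ (λ j → ∑≤1 c _ (small i j)
      (λ k k′ p q → proj₂ (proj₂ (single i j k i j k′ p q))))
    (λ j j′ p q → let k , _ , u = ∑-positive c _ p ; k′ , _ , v = ∑-positive c _ q in
      proj₁ (proj₂ (single i j k i j′ k′ u v))))
  (λ i i′ p q →
    let j , _ , u = ∑-positive b _ p ; k , _ , u′ = ∑-positive c _ u
        j′ , _ , v = ∑-positive b _ q ; k′ , _ , v′ = ∑-positive c _ v in
    proj₁ (single i j k i′ j′ k′ u′ v′))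

1≤2^ : ∀ e → 1 ≤ 2 ^ e
1≤2^ e = ≤-trans (s≤s z≤n) (n<2^n e)

-- Removes a summation variable that the remaining data determine; this is how sums over the left
-- end of a gap disappear.
∑χ≤χ : ∀ n {R : ℕ → Set} {H : Set} (R? : ∀ x → Dec (R x)) (H? : Dec H) →
  (∀ x → R x → H) → (∀ x x′ → R x → R x′ → x ≡ x′) → ∑ n (λ x → χ (R? x)) ≤ χ H?
∑χ≤χ n R? H? sound single with ≡0⊎positive (∑ n (λ x → χ (R? x)))
... | inj₁ eq  = ≤-trans (≤-reflexive eq) z≤n
... | inj₂ pos with ∑-positive n _ pos
...   | x , _ , r = ≤-trans
  (∑≤1 n _ (λ x → χ≤1 (R? x)) (λ x x′ p q → single x x′ (χ-holds p) (χ-holds q)))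
  (χ≥1 H? (sound x (χ-holds r)))

-- The geometric series of `1 / 2 ^ i`, multiplied by `2 ^ n` to stay within the natural numbers.
∑-dyadic-weights : ∀ n → ∑ n (λ i → 2 ^ (n ∸ i)) ≤ 2 * 2 ^ n
∑-dyadic-weights zero    = z≤n
∑-dyadic-weights (suc n) = linear 0 (∑-dyadic-weights n) (identity (2 ^ n) _)
  where
  identity : ∀ w s → 2 * w + s + 2 * w + 0 ≡ 2 * (2 * w) + s
  identity = solve-∀

dyadic-weight : ∀ {n i} → i ≤ n → 2 ^ n ≡ 2 ^ (n ∸ i) * 2 ^ i
dyadic-weight {n} {i} i≤n = trans (cong (2 ^_) (sym (m∸n+n≡m i≤n))) (^-distribˡ-+-* 2 (n ∸ i) i)

∑-initial : ∀ n m → ∑ n (λ i → χ (i <? m)) ≤ m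
∑-initial n m = ≤-trans
  (∑-truncate n m {g = λ _ → 1} (λ i _ → χ≤1 (i <? m)) (λ i pos → χ-holds pos))
  (≤-reflexive (∑-ones m))

∑-from : ℕ → ℕ → (ℕ → ℕ) → ℕ
∑-from v h f = ∑ h (λ o → f (v + o))

∑-from-suc : ∀ v h f → ∑-from v (suc h) f ≡ f v + ∑-from (suc v) h f
∑-from-suc v h f = cong₂ _+_ (cong f (+-identityʳ v)) (∑-cong h (λ o _ → cong f (+-suc v o)))

-- Terms before the first nonzero one contribute nothing. The length `m` is arbitrary, so the number
-- of remaining terms need not be tracked.
∑-by-first : ∀ n f c → (∀ m i → 1 ≤ f i → ∑-from i m f ≤ c) → ∑ n f ≤ c
∑-by-first zero    f c h = z≤n
∑-by-first (suc n) f c h with ≡0⊎positive (f 0)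
... | inj₂ pos = h (suc n) 0 pos
... | inj₁ eq rewrite eq = ∑-by-first n (f ∘ suc) c (λ m i → h m (suc i))

InRange : ℕ → ℕ → Set
InRange c m = c ≤ m × m < 2 * c

inRange? : ∀ c m → Dec (InRange c m)
inRange? c m = (c ≤? m) ×-dec (m <? 2 * c)

range⇒interval : ∀ {c m} → InRange c m → c ≤ m × m < c + c
range⇒interval {c} {m} (lo , hi) = lo , subst (λ c′ → m < c + c′) (+-identityʳ c) hi

dyadic-unique : ∀ i j {m} → InRange (2 ^ i) m → InRange (2 ^ j) m → i ≡ j
dyadic-unique i j (lo , hi) (lo′ , hi′) with <-cmp i j
... | tri< i<j _ _ = ⊥-elim (<⇒≱ hi (≤-trans (^-monoʳ-≤ 2 i<j) lo′))
... | tri≈ _ eq _  = eq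
... | tri> _ _ j<i = ⊥-elim (<⇒≱ hi′ (≤-trans (^-monoʳ-≤ 2 j<i) lo))

-- Words, periods and run starts

module Word {B : Set} (_≟_ : DecidableEquality B) (t : ℕ → B) where

  Per : ℕ → ℕ → ℕ → Set
  Per p x y = ∀ i → x ≤ i → i + p < y → t i ≡ t (i + p)

  Agree : ℕ → ℕ → ℕ → Set
  Agree ℓ x y = ∀ i → x ≤ i → i < y → t i ≡ t (i + ℓ)

  per? : ∀ p x y → Dec (Per p x y)
  per? p x y = map′
    (λ h i x≤i i+p<y → h i x≤i (≤-<-trans (m≤m+n i p) i+p<y) i+p<y)
    (λ h i x≤i _ → h i x≤i)
    (all-in? (λ i → (i + p <? y) →-dec (t i ≟ t (i + p))) x y)

  agree? : ∀ ℓ x y → Dec (Agree ℓ x y)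
  agree? ℓ = all-in? (λ i → t i ≟ t (i + ℓ))

  per-⊆ : ∀ {p x y x′ y′} → x ≤ x′ → y′ ≤ y → Per p x y → Per p x′ y′
  per-⊆ x≤x′ y′≤y per i x′≤i i+p<y′ = per i (≤-trans x≤x′ x′≤i) (<-≤-trans i+p<y′ y′≤y)

  agree-⊆ : ∀ {ℓ x y x′ y′} → x ≤ x′ → y′ ≤ y → Agree ℓ x y → Agree ℓ x′ y′
  agree-⊆ x≤x′ y′≤y agr i x′≤i i<y′ = agr i (≤-trans x≤x′ x′≤i) (<-≤-trans i<y′ y′≤y)

  -- A pair `i , i + d` reaching beyond the prefix is moved left by `p`, which changes neither
  -- letter, until it lies inside; since the prefix has length at least `p + d`, no move passes `x`.
  per-extend : ∀ {p d x y z} → 1 ≤ p → Per p x y → Per d x z → x + (p + d) ≤ z → Per d x y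
  per-extend {p} {d} {x} {y} {z} 1≤p per-p per-d long i = go (suc i) i ≤-refl
    where
    -- Here `n` is fuel exceeding `i`; each move left decreases `i` because `1 ≤ p`.
    go : ∀ n i → i < n → x ≤ i → i + d < y → t i ≡ t (i + d)
    go (suc n) i i<n x≤i i+d<y with i + d <? z
    ... | yes i+d<z = per-d i x≤i i+d<z
    ... | no  i+d≮z with m≤n⇒∃[o]m+o≡n {x + p} {i} (linear 0 (long ⊞ ≮⇒≥ i+d≮z)
                           (solve (x ∷ p ∷ d ∷ z ∷ i ∷ [])))
    ...   | o , refl = trans
      (trans (cong t (swap-last x p o)) (sym (per-p (x + o) (m≤m+n x o)
        (linear d i+d<y (solve (x ∷ p ∷ d ∷ y ∷ o ∷ []))))))
      (trans (go n (x + o) (linear 0 (i<n ⊞ 1≤p) (solve (x ∷ p ∷ n ∷ o ∷ []))) (m≤m+n x o)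
                (linear p i+d<y (solve (x ∷ p ∷ d ∷ y ∷ o ∷ []))))
      (trans (per-p (x + o + d) (≤-trans (m≤m+n x o) (m≤m+n _ d))
                (linear 0 i+d<y (solve (x ∷ p ∷ d ∷ y ∷ o ∷ []))))
             (cong t (swap-all x p o d))))
      where
      swap-last : ∀ x p o → x + p + o ≡ x + o + p
      swap-last = solve-∀
      swap-all : ∀ x p o d → x + o + d + p ≡ x + p + o + d
      swap-all = solve-∀

  -- The first step of Euclid's algorithm in the Fine–Wilf theorem.
  per-difference : ∀ {p d x y} → Per p x y → Per (p + d) x y → x + (p + (p + d)) ≤ y → Per d x y
  per-difference {p} {d} {x} {y} per-p per-q long i x≤i i+d<y with i + (p + d) <? y
  ... | yes lt = trans (per-q i x≤i lt) (trans
          (cong t (i+[p+d] i p d))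
          (sym (per-p (i + d) (≤-trans x≤i (m≤m+n i d)) (subst (_< y) (i+[p+d] i p d) lt))))
    where
    i+[p+d] : ∀ i p d → i + (p + d) ≡ i + d + p
    i+[p+d] = solve-∀
  -- The detour through `i + (p + d)` leaves the block, but then `i - p` lies in it: go back by `p`,
  -- then forward by `p + d`.
  ... | no ≮ with m≤n⇒∃[o]m+o≡n {x + p} {i} (linear 0 (long ⊞ ≮⇒≥ ≮)
                     (solve (x ∷ p ∷ d ∷ y ∷ i ∷ [])))
  ...   | o , refl = trans (cong t (swap-last x p o)) (trans
          (sym (per-p (x + o) (m≤m+n x o) (linear d i+d<y (solve (x ∷ p ∷ d ∷ y ∷ o ∷ [])))))
          (trans (per-q (x + o) (m≤m+n x o) (linear 0 i+d<y (solve (x ∷ p ∷ d ∷ y ∷ o ∷ []))))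
                 (cong t (swap-all x p o d))))
    where
    swap-last : ∀ x p o → x + p + o ≡ x + o + p
    swap-last = solve-∀
    swap-all : ∀ x p o d → x + o + (p + d) ≡ x + p + o + d
    swap-all = solve-∀

  -- The letter at `i + ℓ + d` is a copy both of the one at `i` and of the one at `i + d`. Hence
  -- copies of a block at nearby distances force a short period on it.
  agree-difference : ∀ {ℓ d x y} → Agree ℓ x y → Agree (ℓ + d) x y → Per d x y
  agree-difference {ℓ} {d} agr agr′ i x≤i i+d<y = trans
    (agr′ i x≤i (≤-<-trans (m≤m+n i d) i+d<y)) (trans
    (cong t (shift i ℓ d))
    (sym (agr (i + d) (≤-trans x≤i (m≤m+n i d)) i+d<y)))
    where
    shift : ∀ i ℓ d → i + (ℓ + d) ≡ i + d + ℓ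
    shift = solve-∀

  per-extend-left : ∀ {p x y} r → x ≤ r → Per p r y →
    Per p x y ⊎ ∃[ z ] (x ≤ z × z < r × t z ≢ t (z + p) × Per p (suc z) y)
  per-extend-left {p} {x} {y} r x≤r per with m≤n⇒m<n∨m≡n x≤r
  ... | inj₂ refl = inj₁ per
  per-extend-left {p} {x} {y} (suc r) x≤r per | inj₁ (s≤s x≤r′) with t r ≟ t (r + p)
  ... | no  ≢ = inj₂ (r , x≤r′ , n<1+n r , ≢ , per)
  ... | yes ≡ with per-extend-left r x≤r′ per′
    where
    per′ : Per p r y
    per′ i r≤i i+p<y with m≤n⇒m<n∨m≡n r≤i
    ... | inj₁ r<i  = per i r<i i+p<y
    ... | inj₂ refl = ≡
  ...   | inj₁ all = inj₁ all
  ...   | inj₂ (z , x≤z , z<r , rest) = inj₂ (z , x≤z , m<n⇒m<1+n z<r , rest)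

  -- z is the position just before a segment of length 2σ with minimal period p ≪ σ, and that
  -- period cannot be extended to z.
  RunStart : ℕ → ℕ → ℕ → ℕ → ℕ → Set
  RunStart M σ e z p =
    InRange (2 ^ e) p × 3 * p ≤ σ × suc z + 2 * σ ≤ M × t z ≢ t (z + p) ×
    Per p (suc z) (suc z + 2 * σ) ×
    (∀ d → 1 ≤ d → d < p → ¬ Per d (suc z) (suc z + 2 * σ))

  runStart? : ∀ M σ e z p → Dec (RunStart M σ e z p)
  runStart? M σ e z p =
    inRange? (2 ^ e) p ×-dec (3 * p ≤? σ) ×-dec (suc z + 2 * σ ≤? M) ×-dec ¬? (t z ≟ t (z + p))
    ×-dec per? p (suc z) (suc z + 2 * σ)
    ×-dec all-in? (λ d → ¬? (per? d (suc z) (suc z + 2 * σ))) 1 p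

  Aperiodic : ℕ → ℕ → ℕ → Set
  Aperiodic σ x y = ∀ d → 1 ≤ d → d < suc σ → ¬ (3 * d ≤ σ × Per d x y)

  aperiodic? : ∀ σ x y → Dec (Aperiodic σ x y)
  aperiodic? σ x y = all-in? (λ d → ¬? ((3 * d ≤? σ) ×-dec per? d x y)) 1 (suc σ)

  -- The second half of the segment of a run start; before each of its positions there are at least
  -- `σ` periodic ones.
  Tail : ℕ → ℕ → ℕ → Set
  Tail σ z s = suc z + σ ≤ s × s < suc z + 2 * σ

  -- The common part `[suc z′ , s)` has length at least `σ′`, hence at least `3 * p′`. If the
  -- periods differed, their difference would be a period there and, by `per-extend`, of the whole
  -- second segment, against the minimality of `p′`.
  tails⇒same-period : ∀ e {M σ σ′ z z′ p p′ s} → RunStart M σ e z p → RunStart M σ′ e z′ p′ →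
    Tail σ z s → Tail σ′ z′ s → z ≤ z′ → p ≡ p′
  tails⇒same-period e {σ′ = σ′} {z} {z′} {p} {p′} {s}
    ((lo , hi) , _ , _ , _ , per , _) ((lo′ , hi′) , small′ , _ , _ , per′ , minimal′)
    (_ , s<) (s≥′ , s<′) z≤z′
    with <-cmp p p′ | per-⊆ {p} {y′ = s} (s≤s z≤z′) (<⇒≤ s<) per
                    | per-⊆ {p′} {y′ = s} ≤-refl (<⇒≤ s<′) per′
  ... | tri≈ _ eq _ | _ | _ = eq
  ... | tri< p<p′ _ _ | per-s | per-s′ with m≤n⇒∃[o]m+o≡n p<p′
  ...   | d , refl = ⊥-elim (minimal′ (suc d) (s≤s z≤n)
            (linear 0 (≤-trans (1≤2^ e) lo) (solve (p ∷ d ∷ [])))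
            (per-extend {suc p + d} {suc d} {z = s} (≤-trans (1≤2^ e) lo′) per′
              (per-difference {p} {suc d} per-s
                (subst (λ q → Per q (suc z′) s) (sym (+-suc p d)) per-s′)
                (linear (p + 2 * suc d) (s≥′ ⊞ small′) (solve (z′ ∷ p ∷ d ∷ s ∷ σ′ ∷ []))))
              (linear (2 * p + suc d) (s≥′ ⊞ small′) (solve (z′ ∷ p ∷ d ∷ s ∷ σ′ ∷ [])))))
  tails⇒same-period e {σ′ = σ′} {z} {z′} {p} {p′} {s}
    ((lo , hi) , _ , _ , _ , per , _) ((lo′ , hi′) , small′ , _ , _ , per′ , minimal′)
    (_ , s<) (s≥′ , s<′) z≤z′
      | tri> _ _ p′<p | per-s | per-s′ with m≤n⇒∃[o]m+o≡n p′<p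
  ...   | d , refl = ⊥-elim (minimal′ (suc d) (s≤s z≤n) d<p′
            (per-extend {p′} {suc d} {z = s} (≤-trans (1≤2^ e) lo′) per′
              (per-difference {p′} {suc d} per-s′
                (subst (λ q → Per q (suc z′) s) (sym (+-suc p′ d)) per-s)
                (linear 1 (s≥′ ⊞ small′ ⊞ d<p′) (solve (z′ ∷ p′ ∷ d ∷ s ∷ σ′ ∷ []))))
              (linear (1 + p′) (s≥′ ⊞ small′ ⊞ d<p′) (solve (z′ ∷ p′ ∷ d ∷ s ∷ σ′ ∷ [])))))
    where
    identity : ∀ p d w → suc (suc d) + (2 * w + 2 * p) + 0 ≡ p + (suc (suc (p + d)) + 2 * w)
    identity = solve-∀
    -- Both periods lie in the dyadic range of `2 ^ e`, so `p < 2 * p′`.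
    d<p′ : suc d < p′
    d<p′ = linear 0 (hi ⊞ 2 ⊠ lo′) (identity p′ d (2 ^ e))

  -- The period of the run beginning after `z` would continue through `z′`, where the second run
  -- start demands a break.
  tails⇒≮ : ∀ e {M σ σ′ z z′ p p′ s} → RunStart M σ e z p → RunStart M σ′ e z′ p′ →
    Tail σ z s → Tail σ′ z′ s → ¬ z < z′
  tails⇒≮ e {σ = σ} {σ′} {z} {z′} {p} {s = s} run@(_ , _ , _ , _ , per , _) run′@(_ , small′ , _ , ≢′ , _)
    tail@(_ , s<) tail′@(s≥′ , _) z<z′ with tails⇒same-period e run run′ tail tail′ (<⇒≤ z<z′)
  ... | refl = ≢′ (per z′ z<z′
    (linear (1 + 2 * p) (s< ⊞ s≥′ ⊞ small′) (solve (z ∷ z′ ∷ p ∷ s ∷ σ ∷ σ′ ∷ []))))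

  tail-unique : ∀ i i′ e {M z z′ p p′ s} → RunStart M (2 ^ i) e z p → RunStart M (2 ^ i′) e z′ p′ →
    Tail (2 ^ i) z s → Tail (2 ^ i′) z′ s → i ≡ i′ × z ≡ z′ × p ≡ p′
  tail-unique i i′ e {z = z} {z′} {s = s} run run′ tail tail′ with <-cmp z z′
  ... | tri< z<z′ _ _ = ⊥-elim (tails⇒≮ e run run′ tail tail′ z<z′)
  ... | tri> _ _ z′<z = ⊥-elim (tails⇒≮ e run′ run tail′ tail z′<z)
  -- The offset of `s` from `suc z` lies in `[σ , 2 * σ)`, which determines the dyadic scale.
  ... | tri≈ _ refl _ =
    dyadic-unique i i′ (offset tail) (offset tail′) , refl , tails⇒same-period e run run′ tail tail′ ≤-refl
    where
    offset : ∀ {σ} → Tail σ z s → InRange σ (s ∸ suc z)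
    offset {σ} (s≥ , s<) =
      subst (_≤ s ∸ suc z) (m+n∸m≡n (suc z) σ) (∸-monoˡ-≤ (suc z) s≥) ,
      subst (s ∸ suc z <_) (m+n∸m≡n (suc z) (2 * σ)) (∸-monoˡ-< s< (≤-trans (m≤m+n (suc z) σ) s≥))

  -- Each run start spreads its weight `2 ^ i` over its tail. For a fixed dyadic class `e` of
  -- periods, the tails of all scales together are disjoint by `tail-unique`.
  ∑-runStarts : ∀ M I Z P e →
    ∑₃ I Z P (λ i z p → 2 ^ i * χ (runStart? M (2 ^ i) e z p)) ≤ M
  ∑-runStarts M I Z P e = begin
    ∑₃ I Z P (λ i z p → 2 ^ i * χ (runStart? M (2 ^ i) e z p))
      ≤⟨ ∑₃-mono I Z P (λ i z p → *χ≤ (2 ^ i) (runStart? M (2 ^ i) e z p) (spread i z p)) ⟩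
    ∑₃ I Z P (λ i z p → ∑ M (λ s → χ (covers? i z p s)))
      ≡⟨ sym (∑-∑₃-swap M I Z P (λ s i z p → χ (covers? i z p s))) ⟩
    ∑ M (λ s → ∑₃ I Z P (λ i z p → χ (covers? i z p s)))
      ≤⟨ ∑-bounded M 1 (λ s _ → ∑₃≤1 I Z P _ (λ i z p → χ≤1 (covers? i z p s))
           (λ i z p i′ z′ p′ c c′ →
             let run  , tail  = χ-holds {P? = covers? i z p s} c
                 run′ , tail′ = χ-holds {P? = covers? i′ z′ p′ s} c′
             in tail-unique i i′ e run run′ tail tail′)) ⟩
    M * 1
      ≡⟨ *-identityʳ M ⟩
    M ∎
    where
    open ≤-Reasoning
    covers? : ∀ i z p s → Dec (RunStart M (2 ^ i) e z p × Tail (2 ^ i) z s)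
    covers? i z p s = runStart? M (2 ^ i) e z p ×-dec
      (suc z + 2 ^ i ≤? s) ×-dec (s <? suc z + 2 * 2 ^ i)

    spread : ∀ i z p → RunStart M (2 ^ i) e z p → 2 ^ i ≤ ∑ M (λ s → χ (covers? i z p s))
    spread i z p run@(_ , _ , inside , _) = length≤∑ (suc z + σ) σ _
      (≤-trans (≤-reflexive end) inside)
      (λ o o<σ → χ≥1 (covers? i z p (suc z + σ + o))
        (run , m≤m+n _ o , subst (suc z + σ + o <_) end (+-monoʳ-< (suc z + σ) o<σ)))
      where
      σ = 2 ^ i
      identity : ∀ z σ → suc z + σ + σ ≡ suc z + 2 * σ
      identity = solve-∀
      end : suc z + σ + σ ≡ suc z + 2 * σ
      end = identity z σ

  -- The part, at the dyadic scale σ ≈ ℓ / 4α, of the gaps that agree on at least ℓ / α positions.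
  Class : ℕ → ℕ → ℕ → ℕ → Set
  Class α σ x ℓ = InRange (4 * α * σ) ℓ × t x ≢ t (x + ℓ) × Agree ℓ (suc x) (suc x + 4 * σ)

  class? : ∀ α σ x ℓ → Dec (Class α σ x ℓ)
  class? α σ x ℓ = inRange? (4 * α * σ) ℓ ×-dec ¬? (t x ≟ t (x + ℓ)) ×-dec
    agree? ℓ (suc x) (suc x + 4 * σ)

  -- Anchoring gaps at run starts.

  AnchoredLeft : ℕ → ℕ → ℕ → ℕ → ℕ → ℕ → ℕ → ℕ → Set
  AnchoredLeft M α σ x ℓ e z p = Class α σ x ℓ × (x ≤ z × z ≤ x + σ) × RunStart M σ e z p

  AnchoredRight : ℕ → ℕ → ℕ → ℕ → ℕ → ℕ → ℕ → ℕ → Set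
  AnchoredRight M α σ x ℓ e z p = Class α σ x ℓ × z ≡ x + ℓ × RunStart M σ e z p

  anchoredLeft? : ∀ M α σ x ℓ e z p → Dec (AnchoredLeft M α σ x ℓ e z p)
  anchoredLeft? M α σ x ℓ e z p =
    class? α σ x ℓ ×-dec ((x ≤? z) ×-dec (z ≤? x + σ)) ×-dec runStart? M σ e z p

  anchoredRight? : ∀ M α σ x ℓ e z p → Dec (AnchoredRight M α σ x ℓ e z p)
  anchoredRight? M α σ x ℓ e z p =
    class? α σ x ℓ ×-dec (z ≟ℕ x + ℓ) ×-dec runStart? M σ e z p

  σ≤ : ∀ {α} σ {ℓ} → 1 ≤ α → 4 * α * σ ≤ ℓ → σ ≤ ℓ
  σ≤ {α} σ {ℓ} 1≤α h =
    linear (3 * (α * σ)) (σ ⊠ 1≤α ⊞ h) (solve (α ∷ σ ∷ ℓ ∷ []))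

  -- Let p be the least period of the block [x + 1 + σ , x + 1 + 3σ).  Extended to the left, it
  -- either breaks at some z ≥ x, or still holds at x; then it breaks at x + ℓ, because the shift
  -- ℓ disagrees at x but agrees at x + p.
  classify : ∀ n {α σ x ℓ} → 1 ≤ α → x < n → ℓ < n → Class α σ x ℓ →
    Aperiodic σ (suc x + σ) (suc x + 3 * σ) ⊎
    ∃[ e ] ∃[ z ] ∃[ p ] (e < n × z < 2 * n × p < n ×
      (AnchoredLeft (4 * n) α σ x ℓ e z p ⊎ AnchoredRight (4 * n) α σ x ℓ e z p))
  classify n {α} {σ} {x} {ℓ} 1≤α x<n ℓ<n class@((lo , hi) , ≢ , agr)
    with least (λ d → (1 ≤? d) ×-dec (3 * d ≤? σ) ×-dec per? d (suc x + σ) (suc x + 3 * σ)) (suc σ)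
  ... | inj₂ none = inj₁ λ d 1≤d d≤σ (small , per) → none d d≤σ (1≤d , small , per)
  ... | inj₁ (p , _ , (1≤p , small , per) , least-p) = inj₂ anchor
    where
    σ<n : σ < n
    σ<n = ≤-<-trans (σ≤ σ 1≤α lo) ℓ<n

    p≤σ : p ≤ σ
    p≤σ = ≤-trans (m≤m+n p _) small

    p<n : p < n
    p<n = ≤-<-trans p≤σ σ<n

    -- A shorter period of the first `2 * σ` positions would spread to the right by `per-extend` and
    -- reach the middle block, where `p` is least.
    minimal : ∀ {r} → r ≤ suc x + σ → Per p r (suc x + 3 * σ) →
      ∀ d → 1 ≤ d → d < p → ¬ Per d r (r + 2 * σ)
    minimal {r} r≤ per-r d 1≤d d<p per-d = least-p d d<p
      ( 1≤d
      , ≤-trans (*-monoʳ-≤ 3 (<⇒≤ d<p)) small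
      , per-⊆ r≤ ≤-refl (per-extend 1≤p per-r per-d
          (linear (1 + p + σ) (small ⊞ d<p) (solve (r ∷ p ∷ d ∷ σ ∷ [])))))

    anchor : ∃[ e ] ∃[ z ] ∃[ p ] (e < n × z < 2 * n × p < n ×
      (AnchoredLeft (4 * n) α σ x ℓ e z p ⊎ AnchoredRight (4 * n) α σ x ℓ e z p))
    anchor with dyadic 1 p ≤-refl 1≤p
    ... | e , lo-e , hi-e rewrite *-identityˡ (2 ^ e)
        with per-extend-left {p} {x} (suc x + σ) (≤-trans (n≤1+n x) (m≤m+n (suc x) σ)) per
    ...   | inj₂ (z , x≤z , z<r , ≢z , per-z) =
      e , z , p , <-trans (n<2^n e) (≤-<-trans lo-e p<n) ,
      linear 1 (z<r ⊞ x<n ⊞ σ<n) (solve (x ∷ z ∷ σ ∷ n ∷ [])) ,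
      p<n ,
      inj₁ (class , (x≤z , s≤s⁻¹ z<r) , (lo-e , hi-e) , small ,
        linear 3 (z<r ⊞ x<n ⊞ 3 ⊠ σ<n) (solve (x ∷ z ∷ σ ∷ n ∷ [])) ,
        ≢z ,
        per-⊆ {p} {y = suc x + 3 * σ} {y′ = suc z + 2 * σ} ≤-refl (linear 0 z<r (solve (x ∷ z ∷ σ ∷ []))) per-z ,
        minimal z<r per-z)
    ...   | inj₁ per-x =
      e , x + ℓ , p , <-trans (n<2^n e) (≤-<-trans lo-e p<n) ,
      linear 1 (x<n ⊞ ℓ<n) (solve (x ∷ ℓ ∷ n ∷ [])) ,
      p<n ,
      inj₂ (class , refl , (lo-e , hi-e) , small ,
        linear 3 (x<n ⊞ ℓ<n ⊞ 2 ⊠ σ<n) (solve (x ∷ ℓ ∷ σ ∷ n ∷ [])) ,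
        (λ ≡z → ≢ (trans (per-x x ≤-refl (linear (2 * σ) p≤σ (solve (x ∷ p ∷ σ ∷ []))))
          (trans (agr (x + p)
                   (linear 0 1≤p (solve (x ∷ p ∷ [])))
                   (linear (3 * σ) p≤σ (solve (x ∷ p ∷ σ ∷ []))))
            (trans (cong t (swap x p ℓ)) (sym ≡z))))) ,
        per-z ,
        -- A shorter period of the copy is carried back by the shift `ℓ` to the block at `suc x`.
        (λ d 1≤d d<p per-d → minimal {suc x} (m≤m+n (suc x) σ) (per-⊆ (n≤1+n x) ≤-refl per-x) d 1≤d d<p
          λ i X≤i i+d< → transport i d X≤i
             (linear (2 * σ) i+d< (solve (x ∷ i ∷ d ∷ σ ∷ [])))
             (per-d (i + ℓ) (+-monoˡ-≤ ℓ X≤i) (linear 0 i+d< (solve (x ∷ i ∷ d ∷ σ ∷ ℓ ∷ []))))))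
      where
      swap : ∀ a b c → a + b + c ≡ a + c + b
      swap = solve-∀

      transport : ∀ i d → suc x ≤ i → i + d < suc x + 4 * σ →
        t (i + ℓ) ≡ t (i + ℓ + d) → t i ≡ t (i + d)
      transport i d X≤i i+d< eq =
        trans (agr i X≤i (≤-<-trans (m≤m+n i d) i+d<)) (trans eq
        (trans (cong t (swap i ℓ d)) (sym (agr (i + d) (≤-trans X≤i (m≤m+n i d)) i+d<))))

      per-z : Per p (suc (x + ℓ)) (suc (x + ℓ) + 2 * σ)
      per-z i Z≤i i+p< with m≤n⇒∃[o]m+o≡n Z≤i
      ... | o , refl = trans (cong t (shift x ℓ o))
        (trans (sym (agr (suc x + o) (m≤m+n (suc x) o) (linear (p + 2 * σ) i+p< (solve (x ∷ o ∷ p ∷ ℓ ∷ σ ∷ [])))))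
        (trans (per-x (suc x + o) (≤-trans (n≤1+n x) (m≤m+n (suc x) o)) (linear σ i+p< (solve (x ∷ o ∷ p ∷ ℓ ∷ σ ∷ []))))
        (trans (agr (suc x + o + p) (≤-trans (m≤m+n (suc x) o) (m≤m+n _ p)) (linear (2 * σ) i+p< (solve (x ∷ o ∷ p ∷ ℓ ∷ σ ∷ []))))
        (cong t (shift′ x ℓ o p)))))
        where
        shift : ∀ x ℓ o → suc (x + ℓ) + o ≡ suc x + o + ℓ
        shift = solve-∀
        shift′ : ∀ x ℓ o p → suc x + o + p + ℓ ≡ suc (x + ℓ) + o + p
        shift′ = solve-∀

  -- Counting the copies of a fixed block.

  AperiodicCopy : ℕ → ℕ → ℕ → ℕ → Set
  AperiodicCopy α σ s ℓ = InRange (4 * α * σ) ℓ × Agree ℓ s (s + 3 * σ) × Aperiodic σ s (s + 3 * σ)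

  aperiodicCopy? : ∀ α σ s ℓ → Dec (AperiodicCopy α σ s ℓ)
  aperiodicCopy? α σ s ℓ =
    inRange? (4 * α * σ) ℓ ×-dec agree? ℓ s (s + 3 * σ) ×-dec aperiodic? σ s (s + 3 * σ)

  -- Distances differing by at most `σ / 3` would give the block a forbidden period. So the
  -- distances are spaced by `σ / 3` in an interval of length `4 * α * σ`, which allows `12 * α + 1`
  -- of them.
  ∑-aperiodicCopies : ∀ n {α σ} s → 1 ≤ α → 1 ≤ σ → ∑ n (λ ℓ → χ (aperiodicCopy? α σ s ℓ)) ≤ 13 * α
  ∑-aperiodicCopies n {α} {σ} s 1≤α 1≤σ = *-cancelˡ-≤ σ {{>-nonZero 1≤σ}} (linear 0
    (spaced-count σ 3 (4 * α * σ) n (4 * α * σ) (aperiodicCopy? α σ s) spaced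
      (λ _ (range , _) → range⇒interval range)
     ⊞ σ ⊠ 1≤α)
    (identity α σ (∑ n (λ ℓ → χ (aperiodicCopy? α σ s ℓ)))))
    where
    identity : ∀ α σ S → σ * S + (3 * (4 * α * σ) + σ + σ * α) + 0 ≡ σ * (13 * α) + (σ * S + σ * 1)
    identity = solve-∀
    spaced : Spaced σ 3 (AperiodicCopy α σ s)
    spaced ℓ d (_ , agr , aperiodic) (_ , agr′ , _) with 3 * suc d ≤? σ
    ... | no  ≰ = <⇒≤ (≰⇒> ≰)
    ... | yes small = ⊥-elim (aperiodic (suc d) (s≤s z≤n) (s≤s (≤-trans (m≤m+n (suc d) _) small))
      (small , agree-difference {ℓ} {suc d} agr agr′))

  module _ (M α σ e z p : ℕ) where

    LeftCopy : ℕ → Set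
    LeftCopy ℓ = InRange (4 * α * σ) ℓ × RunStart M σ e z p × Agree ℓ (suc z) (suc z + 2 * σ)

    -- For a run start at `x + ℓ` the copy lies to its left; `ℓ ≤ suc z` makes the truncated
    -- subtraction exact.
    RightCopy : ℕ → Set
    RightCopy ℓ = InRange (4 * α * σ) ℓ × RunStart M σ e z p × ℓ ≤ suc z ×
      (∀ i → suc z ≤ i → i < suc z + 2 * σ → t (i ∸ ℓ) ≡ t i)

    leftCopy? : ∀ ℓ → Dec (LeftCopy ℓ)
    leftCopy? ℓ =
      inRange? (4 * α * σ) ℓ ×-dec runStart? M σ e z p ×-dec agree? ℓ (suc z) (suc z + 2 * σ)

    rightCopy? : ∀ ℓ → Dec (RightCopy ℓ)
    rightCopy? ℓ = inRange? (4 * α * σ) ℓ ×-dec runStart? M σ e z p ×-dec (ℓ ≤? suc z) ×-dec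
      all-in? (λ i → t (i ∸ ℓ) ≟ t i) (suc z) (suc z + 2 * σ)

    minimal⇒spaced : RunStart M σ e z p → ∀ {d} → Per (suc d) (suc z) (suc z + 2 * σ) → p ≤ 1 * suc d
    minimal⇒spaced (_ , _ , _ , _ , _ , minimal) {d} per with p ≤? suc d
    ... | yes p≤d = ≤-trans p≤d (≤-reflexive (sym (*-identityˡ (suc d))))
    ... | no  p≰d = ⊥-elim (minimal (suc d) (s≤s z≤n) (≰⇒> p≰d) per)

    left-spaced : Spaced p 1 LeftCopy
    left-spaced ℓ d (_ , run , agr) (_ , _ , agr′) =
      minimal⇒spaced run (agree-difference {ℓ} {suc d} agr agr′)

    right-spaced : Spaced p 1 RightCopy
    right-spaced ℓ d (_ , run , ℓ≤Z , back) (_ , _ , ℓ′≤Z , back′) = minimal⇒spaced run λ i Z≤i i+d< →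
      trans (sym (back i Z≤i (≤-<-trans (m≤m+n i (suc d)) i+d<))) (trans
        (cong t (sym (trans (cong (i + suc d ∸_) (+-comm ℓ (suc d)))
                     (trans (sym (∸-+-assoc (i + suc d) (suc d) ℓ)) (cong (_∸ ℓ) (m+n∸n≡m i (suc d)))))))
        (back′ (i + suc d) (≤-trans Z≤i (m≤m+n i (suc d))) i+d<))

    -- Copies spaced by `p` in an interval of length `4 * α * σ` number at most `4 * α * σ / p + 1`,
    -- and `p ≤ σ` absorbs the summand 1. Using `2 ^ e ≤ p` in place of `p` leaves a bound that
    -- depends on the period only through its dyadic class.
    ∑-spacedCopies : 1 ≤ α → ∀ n {H : ℕ → Set} (H? : ∀ ℓ → Dec (H ℓ)) →
      (∀ ℓ → H ℓ → InRange (4 * α * σ) ℓ) → (∀ ℓ → H ℓ → RunStart M σ e z p) → Spaced p 1 H →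
      2 ^ e * ∑ n (λ ℓ → χ (H? ℓ)) ≤ 5 * α * σ * χ (runStart? M σ e z p)
    ∑-spacedCopies 1≤α n H? range starts spaced with runStart? M σ e z p
    ... | no ¬run = ≤-trans
      (*-monoʳ-≤ (2 ^ e) (≤-trans
        (∑-bounded n 0 (λ ℓ _ → χ≤ (H? ℓ) (λ h → ⊥-elim (¬run (starts ℓ h)))))
        (≤-reflexive (*-zeroʳ n))))
      (≤-trans (≤-reflexive (*-zeroʳ (2 ^ e))) z≤n)
    ... | yes ((2^e≤p , _) , small , _) = linear (2 * p)
      (*-monoˡ-≤ (∑ n (λ ℓ → χ (H? ℓ))) 2^e≤p
        ⊞ spaced-count p 1 (4 * α * σ) n (4 * α * σ) H? spaced (λ ℓ h → range⇒interval (range ℓ h))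
        ⊞ small ⊞ σ ⊠ 1≤α)
      (identity (2 ^ e) p α σ (∑ n (λ ℓ → χ (H? ℓ))))
      where
      identity : ∀ w p α σ S →
        w * S + (p * S + (1 * (4 * α * σ) + p + (σ + σ * α))) + 2 * p ≡
        5 * α * σ * 1 + (w * S + (p * S + (3 * p + σ * 1)))
      identity = solve-∀

  copiesAt : ℕ → ℕ → ℕ → ℕ → ℕ → ℕ → ℕ → ℕ
  copiesAt n α i e z p ℓ =
    χ (leftCopy? (4 * n) α (2 ^ i) e z p ℓ) + χ (rightCopy? (4 * n) α (2 ^ i) e z p ℓ)

  ∑-copiesAt : ∀ n {α} → 1 ≤ α → ∀ i e z p →
    2 ^ e * ∑ n (copiesAt n α i e z p) ≤ 10 * α * (2 ^ i * χ (runStart? (4 * n) (2 ^ i) e z p))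
  ∑-copiesAt n {α} 1≤α i e z p = ≤-trans (≤-reflexive (cong (2 ^ e *_) (∑-distrib-+ n _ _))) (linear 0
    (∑-spacedCopies (4 * n) α (2 ^ i) e z p 1≤α n (leftCopy? (4 * n) α (2 ^ i) e z p)
       (λ _ → proj₁) (λ _ h → proj₁ (proj₂ h)) (left-spaced (4 * n) α (2 ^ i) e z p)
     ⊞ ∑-spacedCopies (4 * n) α (2 ^ i) e z p 1≤α n (rightCopy? (4 * n) α (2 ^ i) e z p)
       (λ _ → proj₁) (λ _ h → proj₁ (proj₂ h)) (right-spaced (4 * n) α (2 ^ i) e z p))
    (identity (2 ^ e) _ _ α (2 ^ i) _))
    where
    identity : ∀ w S S′ α σ c →
      w * (S + S′) + (5 * α * σ * c + 5 * α * σ * c) + 0 ≡ 10 * α * (σ * c) + (w * S + w * S′)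
    identity = solve-∀

  -- Each charge determines its gap.

  -- A left end is a disagreement, whereas the `4 * σ` positions after a left end all agree.
  class-unique : ∀ {α σ ℓ x x′} → Class α σ x ℓ → Class α σ x′ ℓ →
    x′ < suc x + 4 * σ → x < suc x′ + 4 * σ → x ≡ x′
  class-unique {x = x} {x′} (_ , ≢ , agr) (_ , ≢′ , agr′) near near′ with <-cmp x x′
  ... | tri< x<x′ _ _ = ⊥-elim (≢′ (agr x′ x<x′ near))
  ... | tri≈ _ eq _   = eq
  ... | tri> _ _ x′<x = ⊥-elim (≢ (agr′ x x′<x near′))

  -- The lengths fit together: for each of these `σ` values of `s`, the block `[s , s + 3 * σ)` lies
  -- in the agreeing block of length `4 * σ` and contains its aperiodic middle of length `2 * σ`.
  NearAperiodic : ℕ → ℕ → ℕ → ℕ → ℕ → Set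
  NearAperiodic α σ x ℓ s =
    Class α σ x ℓ × Aperiodic σ (suc x + σ) (suc x + 3 * σ) × suc x ≤ s × s < suc x + σ

  nearAperiodic? : ∀ α σ x ℓ s → Dec (NearAperiodic α σ x ℓ s)
  nearAperiodic? α σ x ℓ s = class? α σ x ℓ ×-dec aperiodic? σ (suc x + σ) (suc x + 3 * σ) ×-dec
    (suc x ≤? s) ×-dec (s <? suc x + σ)

  ∑-nearAperiodic : ∀ n α σ ℓ s →
    ∑ n (λ x → χ (nearAperiodic? α σ x ℓ s)) ≤ χ (aperiodicCopy? α σ s ℓ)
  ∑-nearAperiodic n α σ ℓ s = ∑χ≤χ n _ _
    (λ { x ((range , _ , agr) , aper , X≤s , s<) →
      range ,
      agree-⊆ {ℓ} {y = suc x + 4 * σ} {y′ = s + 3 * σ} X≤s (linear 1 s< (solve (x ∷ s ∷ σ ∷ []))) agr ,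
      (λ d 1≤d d≤σ (small , per) → aper d 1≤d d≤σ
        (small , per-⊆ {d} (<⇒≤ s<) (+-monoˡ-≤ (3 * σ) X≤s) per)) })
    (λ { x x′ (c , _ , X≤s , s<) (c′ , _ , X′≤s , s<′) → class-unique {α} {σ} c c′
      (linear (1 + 3 * σ) (X′≤s ⊞ s<) (solve (x ∷ x′ ∷ s ∷ σ ∷ [])))
      (linear (1 + 3 * σ) (X≤s ⊞ s<′) (solve (x ∷ x′ ∷ s ∷ σ ∷ []))) })

  ∑-anchoredLeft : ∀ n M α σ ℓ e z p →
    ∑ n (λ x → χ (anchoredLeft? M α σ x ℓ e z p)) ≤ χ (leftCopy? M α σ e z p ℓ)
  ∑-anchoredLeft n M α σ ℓ e z p = ∑χ≤χ n _ _
    (λ { x ((range , _ , agr) , (x≤z , z≤) , run) → range , run ,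
      agree-⊆ {ℓ} {y = suc x + 4 * σ} {y′ = suc z + 2 * σ}
        (s≤s x≤z) (linear σ z≤ (solve (x ∷ z ∷ σ ∷ []))) agr })
    (λ { x x′ (c , (x≤z , z≤) , _) (c′ , (x′≤z , z≤′) , _) → class-unique {α} {σ} c c′
      (linear (3 * σ) (x′≤z ⊞ z≤) (solve (x ∷ x′ ∷ z ∷ σ ∷ [])))
      (linear (3 * σ) (x≤z ⊞ z≤′) (solve (x ∷ x′ ∷ z ∷ σ ∷ []))) })

  ∑-anchoredRight : ∀ n M α σ ℓ e z p →
    ∑ n (λ x → χ (anchoredRight? M α σ x ℓ e z p)) ≤ χ (rightCopy? M α σ e z p ℓ)
  ∑-anchoredRight n M α σ ℓ e z p = ∑χ≤χ n _ _ sound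
    (λ { x x′ (_ , z≡ , _) (_ , z≡′ , _) → +-cancelʳ-≡ ℓ x x′ (trans (sym z≡) z≡′) })
    where
    sound : ∀ x → AnchoredRight M α σ x ℓ e z p → RightCopy M α σ e z p ℓ
    sound x ((range , _ , agr) , refl , run) =
      range , run , ≤-trans (m≤n+m ℓ x) (n≤1+n (x + ℓ)) , back
      where
      back : ∀ i → suc (x + ℓ) ≤ i → i < suc (x + ℓ) + 2 * σ → t (i ∸ ℓ) ≡ t i
      back i Z≤i i< with m≤n⇒∃[o]m+o≡n Z≤i
      ... | o , refl = trans
        (cong t (trans (cong (_∸ ℓ) (shift x ℓ o)) (m+n∸n≡m (suc x + o) ℓ)))
        (trans (agr (suc x + o) (m≤m+n (suc x) o)
                 (linear (2 * σ) i< (solve (x ∷ ℓ ∷ o ∷ σ ∷ []))))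
               (cong t (sym (shift x ℓ o))))
        where
        shift : ∀ x ℓ o → suc (x + ℓ) + o ≡ suc x + o + ℓ
        shift = solve-∀

  -- The redundant bound o < ℓ makes decidability evident.
  Gap : ℕ → ℕ → ℕ → Set
  Gap α x ℓ = t x ≢ t (x + ℓ) ×
    (∀ o → 0 ≤ o → o < ℓ → α * o < ℓ → t (suc x + o) ≡ t (suc x + o + ℓ))

  gap? : ∀ α x ℓ → Dec (Gap α x ℓ)
  gap? α x ℓ = ¬? (t x ≟ t (x + ℓ)) ×-dec
    all-in? (λ o → (α * o <? ℓ) →-dec (t (suc x + o) ≟ t (suc x + o + ℓ))) 0 ℓ

  -- Summing the gaps over all scales.

  module _ (n : ℕ) {α : ℕ} (1≤α : 1 ≤ α) where

    anchored : ℕ → ℕ → ℕ → ℕ → ℕ → ℕ → ℕ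
    anchored i x ℓ e z p =
      χ (anchoredLeft? (4 * n) α (2 ^ i) x ℓ e z p) + χ (anchoredRight? (4 * n) α (2 ^ i) x ℓ e z p)

    -- The dichotomy of `classify` as an inequality: a gap with aperiodic middle charges `σ`
    -- positions, any other gap charges `σ` to a run start.
    class-charge : ∀ i {x ℓ} → x < n → ℓ < n → 2 ^ i * χ (class? α (2 ^ i) x ℓ) ≤
      ∑ (4 * n) (λ s → χ (nearAperiodic? α (2 ^ i) x ℓ s)) +
      2 ^ i * ∑₃ n (2 * n) n (anchored i x ℓ)
    class-charge i {x} {ℓ} x<n ℓ<n = *χ≤ σ (class? α σ x ℓ) charge
      where
      σ = 2 ^ i

      end : ∀ {σ} → σ ≤ ℓ → suc x + σ ≤ 4 * n
      end {σ} σ≤ℓ = linear (2 * n + 1) (x<n ⊞ σ≤ℓ ⊞ ℓ<n) (solve (x ∷ σ ∷ ℓ ∷ n ∷ []))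

      charge : Class α σ x ℓ → σ ≤
        ∑ (4 * n) (λ s → χ (nearAperiodic? α σ x ℓ s)) + σ * ∑₃ n (2 * n) n (anchored i x ℓ)
      charge class with classify n {α} {σ} 1≤α x<n ℓ<n class
      ... | inj₁ aper = ≤-trans
        (length≤∑ (suc x) σ _ (end (σ≤ {α} σ 1≤α (proj₁ (proj₁ class))))
          (λ o o<σ → χ≥1 (nearAperiodic? α σ x ℓ (suc x + o))
            (class , aper , m≤m+n (suc x) o , +-monoʳ-< (suc x) o<σ)))
        (m≤m+n _ _)
      ... | inj₂ (e , z , p , e<n , z<2n , p<n , anchor) = begin
        σ      ≡⟨ sym (*-identityʳ σ) ⟩
        σ * 1  ≤⟨ *-monoʳ-≤ σ (≤-trans (counted anchor)
                    (∑₃-term (anchored i x ℓ) e<n z<2n p<n)) ⟩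
        σ * ∑₃ n (2 * n) n (anchored i x ℓ)  ≤⟨ m≤n+m _ _ ⟩
        _      ∎
        where
        open ≤-Reasoning
        counted : AnchoredLeft (4 * n) α σ x ℓ e z p ⊎ AnchoredRight (4 * n) α σ x ℓ e z p →
          1 ≤ anchored i x ℓ e z p
        counted (inj₁ l) = ≤-trans (χ≥1 (anchoredLeft? (4 * n) α σ x ℓ e z p) l) (m≤m+n _ _)
        counted (inj₂ r) = ≤-trans (χ≥1 (anchoredRight? (4 * n) α σ x ℓ e z p) r) (m≤n+m _ _)

    class-column : ∀ i {ℓ} → ℓ < n → 2 ^ i * ∑ n (λ x → χ (class? α (2 ^ i) x ℓ)) ≤
      ∑ (4 * n) (λ s → χ (aperiodicCopy? α (2 ^ i) s ℓ)) +
      2 ^ i * ∑₃ n (2 * n) n (λ e z p → copiesAt n α i e z p ℓ)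
    class-column i {ℓ} ℓ<n = begin
      σ * ∑ n (λ x → χ (class? α σ x ℓ))
        ≡⟨ *-distribˡ-∑ σ n _ ⟩
      ∑ n (λ x → σ * χ (class? α σ x ℓ))
        ≤⟨ ∑-mono n (λ x x<n → class-charge i x<n ℓ<n) ⟩
      ∑ n (λ x → ∑ (4 * n) (λ s → χ (nearAperiodic? α σ x ℓ s)) +
                 σ * ∑₃ n (2 * n) n (anchored i x ℓ))
        ≡⟨ ∑-distrib-+ n _ _ ⟩
      ∑ n (λ x → ∑ (4 * n) (λ s → χ (nearAperiodic? α σ x ℓ s))) +
      ∑ n (λ x → σ * ∑₃ n (2 * n) n (anchored i x ℓ))
        ≡⟨ cong₂ _+_ (∑-swap n (4 * n) _)
             (trans (sym (*-distribˡ-∑ σ n _)) (cong (σ *_) (∑-∑₃-swap n n (2 * n) n _))) ⟩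
      ∑ (4 * n) (λ s → ∑ n (λ x → χ (nearAperiodic? α σ x ℓ s))) +
      σ * ∑₃ n (2 * n) n (λ e z p → ∑ n (λ x → anchored i x ℓ e z p))
        ≤⟨ ∑-mono (4 * n) (λ s _ → ∑-nearAperiodic n α σ ℓ s)
           ⊞ *-monoʳ-≤ σ (∑₃-mono n (2 * n) n (λ e z p → ≤-trans
               (≤-reflexive (∑-distrib-+ n _ _))
               (∑-anchoredLeft n (4 * n) α σ ℓ e z p ⊞ ∑-anchoredRight n (4 * n) α σ ℓ e z p))) ⟩
      ∑ (4 * n) (λ s → χ (aperiodicCopy? α σ s ℓ)) +
      σ * ∑₃ n (2 * n) n (λ e z p → copiesAt n α i e z p ℓ) ∎
      where
      open ≤-Reasoning
      σ = 2 ^ i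

    classes : ℕ → ℕ
    classes i = ∑ n (λ ℓ → ∑ n (λ x → χ (class? α (2 ^ i) x ℓ)))

    copies : ℕ → ℕ → ℕ → ℕ → ℕ
    copies i e z p = ∑ n (copiesAt n α i e z p)

    class-total : ∀ i → 2 ^ i * classes i ≤ 4 * n * (13 * α) + 2 ^ i * ∑₃ n (2 * n) n (copies i)
    class-total i = begin
      σ * classes i
        ≡⟨ *-distribˡ-∑ σ n _ ⟩
      ∑ n (λ ℓ → σ * ∑ n (λ x → χ (class? α σ x ℓ)))
        ≤⟨ ∑-mono n (λ ℓ ℓ<n → class-column i ℓ<n) ⟩
      ∑ n (λ ℓ → ∑ (4 * n) (λ s → χ (aperiodicCopy? α σ s ℓ)) +
                 σ * ∑₃ n (2 * n) n (λ e z p → copiesAt n α i e z p ℓ))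
        ≡⟨ ∑-distrib-+ n _ _ ⟩
      ∑ n (λ ℓ → ∑ (4 * n) (λ s → χ (aperiodicCopy? α σ s ℓ))) +
      ∑ n (λ ℓ → σ * ∑₃ n (2 * n) n (λ e z p → copiesAt n α i e z p ℓ))
        ≡⟨ cong₂ _+_ (∑-swap n (4 * n) _)
             (trans (sym (*-distribˡ-∑ σ n _)) (cong (σ *_) (∑-∑₃-swap n n (2 * n) n _))) ⟩
      ∑ (4 * n) (λ s → ∑ n (λ ℓ → χ (aperiodicCopy? α σ s ℓ))) +
      σ * ∑₃ n (2 * n) n (copies i)
        ≤⟨ +-monoˡ-≤ _ (∑-bounded (4 * n) (13 * α) (λ s _ → ∑-aperiodicCopies n s 1≤α (1≤2^ i))) ⟩
      4 * n * (13 * α) + σ * ∑₃ n (2 * n) n (copies i) ∎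
      where
      open ≤-Reasoning
      σ = 2 ^ i

    -- Multiplying by the dyadic weight turns the bound at scale 2 ^ i into one over a common
    -- denominator 2 ^ n.
    weighted-classes : 2 ^ n * ∑ n classes ≤
      ∑ n (λ i → 2 ^ (n ∸ i)) * (52 * α * n) + 2 ^ n * ∑ n (λ i → ∑₃ n (2 * n) n (copies i))
    weighted-classes = begin
      2 ^ n * ∑ n classes
        ≡⟨ *-distribˡ-∑ (2 ^ n) n _ ⟩
      ∑ n (λ i → 2 ^ n * classes i)
        ≤⟨ ∑-mono n (λ i i<n → pointwise i (<⇒≤ i<n)) ⟩
      ∑ n (λ i → 2 ^ (n ∸ i) * (52 * α * n) + 2 ^ n * ∑₃ n (2 * n) n (copies i))
        ≡⟨ ∑-distrib-+ n _ _ ⟩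
      ∑ n (λ i → 2 ^ (n ∸ i) * (52 * α * n)) + ∑ n (λ i → 2 ^ n * ∑₃ n (2 * n) n (copies i))
        ≡⟨ cong₂ _+_ (sym (*-distribʳ-∑ (52 * α * n) n _)) (sym (*-distribˡ-∑ (2 ^ n) n _)) ⟩
      ∑ n (λ i → 2 ^ (n ∸ i)) * (52 * α * n) + 2 ^ n * ∑ n (λ i → ∑₃ n (2 * n) n (copies i)) ∎
      where
      open ≤-Reasoning
      expand : ∀ w σ n α S → w * (4 * n * (13 * α) + σ * S) ≡ w * (52 * α * n) + w * σ * S
      expand = solve-∀
      pointwise : ∀ i → i ≤ n → 2 ^ n * classes i ≤
        2 ^ (n ∸ i) * (52 * α * n) + 2 ^ n * ∑₃ n (2 * n) n (copies i)
      pointwise i i≤n rewrite dyadic-weight i≤n = begin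
        w * σ * classes i
          ≡⟨ *-assoc w σ _ ⟩
        w * (σ * classes i)
          ≤⟨ *-monoʳ-≤ w (class-total i) ⟩
        w * (4 * n * (13 * α) + σ * ∑₃ n (2 * n) n (copies i))
          ≡⟨ expand w σ n α _ ⟩
        w * (52 * α * n) + w * σ * ∑₃ n (2 * n) n (copies i) ∎
        where
        w = 2 ^ (n ∸ i)
        σ = 2 ^ i

    -- Exchanging the sums fixes `e` first: by `∑-runStarts` the run starts of one dyadic class of
    -- periods have total weight at most `4 * n` over all scales. The factor `2 ^ (n ∸ e)` is kept
    -- for a geometric series.
    weighted-copies : 2 ^ n * ∑ n (λ i → ∑₃ n (2 * n) n (copies i)) ≤
      ∑ n (λ e → 2 ^ (n ∸ e)) * (40 * α * n)
    weighted-copies = begin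
      2 ^ n * ∑ n (λ i → ∑₃ n (2 * n) n (copies i))
        ≡⟨ cong (2 ^ n *_) (∑-swap n n _) ⟩
      2 ^ n * ∑ n (λ e → ∑₃ n (2 * n) n (λ i z p → copies i e z p))
        ≡⟨ *-distribˡ-∑ (2 ^ n) n _ ⟩
      ∑ n (λ e → 2 ^ n * ∑₃ n (2 * n) n (λ i z p → copies i e z p))
        ≤⟨ ∑-mono n (λ e e<n → pointwise e (<⇒≤ e<n)) ⟩
      ∑ n (λ e → 2 ^ (n ∸ e) * (40 * α * n))
        ≡⟨ sym (*-distribʳ-∑ (40 * α * n) n _) ⟩
      ∑ n (λ e → 2 ^ (n ∸ e)) * (40 * α * n) ∎
      where
      open ≤-Reasoning
      collect : ∀ w n α → w * (10 * α * (4 * n)) ≡ w * (40 * α * n)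
      collect = solve-∀
      pointwise : ∀ e → e ≤ n →
        2 ^ n * ∑₃ n (2 * n) n (λ i z p → copies i e z p) ≤ 2 ^ (n ∸ e) * (40 * α * n)
      pointwise e e≤n = begin
        2 ^ n * ∑₃ n (2 * n) n (λ i z p → copies i e z p)
          ≡⟨ cong (_* ∑₃ n (2 * n) n (λ i z p → copies i e z p)) (dyadic-weight e≤n) ⟩
        w * 2 ^ e * ∑₃ n (2 * n) n (λ i z p → copies i e z p)
          ≡⟨ *-assoc w (2 ^ e) _ ⟩
        w * (2 ^ e * ∑₃ n (2 * n) n (λ i z p → copies i e z p))
          ≡⟨ cong (w *_) (*-distribˡ-∑₃ (2 ^ e) n (2 * n) n _) ⟩
        w * ∑₃ n (2 * n) n (λ i z p → 2 ^ e * copies i e z p)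
          ≤⟨ *-monoʳ-≤ w (∑₃-mono n (2 * n) n (λ i z p → ∑-copiesAt n 1≤α i e z p)) ⟩
        w * ∑₃ n (2 * n) n (λ i z p → 10 * α * (2 ^ i * χ (runStart? (4 * n) (2 ^ i) e z p)))
          ≡⟨ cong (w *_) (sym (*-distribˡ-∑₃ (10 * α) n (2 * n) n _)) ⟩
        w * (10 * α * ∑₃ n (2 * n) n (λ i z p → 2 ^ i * χ (runStart? (4 * n) (2 ^ i) e z p)))
          ≤⟨ *-monoʳ-≤ w (*-monoʳ-≤ (10 * α) (∑-runStarts (4 * n) n (2 * n) n e)) ⟩
        w * (10 * α * (4 * n))
          ≡⟨ collect w n α ⟩
        w * (40 * α * n) ∎
        where w = 2 ^ (n ∸ e)

    ∑-classes : ∑ n classes ≤ 184 * α * n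
    ∑-classes = *-cancelˡ-≤ (2 ^ n) {{>-nonZero (1≤2^ n)}} (begin
      2 ^ n * ∑ n classes
        ≤⟨ ≤-trans weighted-classes (+-monoʳ-≤ _ weighted-copies) ⟩
      W * (52 * α * n) + W * (40 * α * n)
        ≡⟨ collect W α n ⟩
      W * (92 * α * n)
        ≤⟨ *-monoˡ-≤ (92 * α * n) (∑-dyadic-weights n) ⟩
      2 * 2 ^ n * (92 * α * n)
        ≡⟨ regroup (2 ^ n) α n ⟩
      2 ^ n * (184 * α * n) ∎)
      where
      open ≤-Reasoning
      W = ∑ n (λ i → 2 ^ (n ∸ i))
      collect : ∀ W α n → W * (52 * α * n) + W * (40 * α * n) ≡ W * (92 * α * n)
      collect = solve-∀
      regroup : ∀ w α n → 2 * w * (92 * α * n) ≡ w * (184 * α * n)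
      regroup = solve-∀

    gap⇒class : ∀ {x ℓ} → ℓ < n → 4 * α ≤ ℓ → Gap α x ℓ →
      ∃[ i ] (i < n × Class α (2 ^ i) x ℓ)
    gap⇒class {x} {ℓ} ℓ<n 4α≤ℓ (≢ , agr)
      with dyadic (4 * α) ℓ (≤-trans 1≤α (m≤m+n α _)) 4α≤ℓ
    ... | i , lo , hi = i ,
      <-trans (n<2^n i) (≤-<-trans (σ≤ {α} (2 ^ i) 1≤α lo) ℓ<n) , (lo , hi) , ≢ , agree
      where
      agree : Agree ℓ (suc x) (suc x + 4 * 2 ^ i)
      agree j X≤j j< with m≤n⇒∃[o]m+o≡n X≤j
      ... | o , refl = agr o z≤n (≤-<-trans o≤αo αo<ℓ) αo<ℓ
        where
        o< : o < 4 * 2 ^ i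
        o< = +-cancelˡ-< (suc x) o _ j<
        o≤αo : o ≤ α * o
        o≤αo = ≤-trans (≤-reflexive (sym (*-identityˡ o))) (*-monoˡ-≤ o 1≤α)
        identity : ∀ α w → α * (4 * w) ≡ 4 * α * w
        identity = solve-∀
        αo<ℓ : α * o < ℓ
        αo<ℓ = <-≤-trans (*-monoʳ-< α {{>-nonZero 1≤α}} o<)
          (≤-trans (≤-reflexive (identity α (2 ^ i))) lo)

    -- Distances below `4 * α` are too short for a scale `σ ≥ 1` and are counted trivially, at most
    -- `n` gaps for each; every other gap belongs to a class.
    ∑-gaps : ∑ n (λ ℓ → ∑ n (λ x → χ (gap? α x ℓ))) ≤ 188 * α * n
    ∑-gaps = begin
      ∑ n (λ ℓ → ∑ n (λ x → χ (gap? α x ℓ)))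
        ≤⟨ ∑-mono n (λ ℓ ℓ<n → ∑-mono n (λ x _ → pointwise ℓ<n)) ⟩
      ∑ n (λ ℓ → ∑ n (λ x → χ (ℓ <? 4 * α) + ∑ n (λ i → χ (class? α (2 ^ i) x ℓ))))
        ≤⟨ ∑-mono n (λ ℓ _ → ≤-trans (≤-reflexive (∑-distrib-+ n _ _))
             (∑-bounded n _ (λ _ _ → ≤-refl) ⊞ ≤-reflexive (∑-swap n n _))) ⟩
      ∑ n (λ ℓ → n * χ (ℓ <? 4 * α) + ∑ n (λ i → ∑ n (λ x → χ (class? α (2 ^ i) x ℓ))))
        ≡⟨ ∑-distrib-+ n _ _ ⟩
      ∑ n (λ ℓ → n * χ (ℓ <? 4 * α)) + ∑ n (λ ℓ → ∑ n (λ i → ∑ n (λ x → χ (class? α (2 ^ i) x ℓ))))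
        ≡⟨ cong₂ _+_ (sym (*-distribˡ-∑ n n _)) (∑-swap n n _) ⟩
      n * ∑ n (λ ℓ → χ (ℓ <? 4 * α)) + ∑ n classes
        ≤⟨ *-monoʳ-≤ n (∑-initial n (4 * α)) ⊞ ∑-classes ⟩
      n * (4 * α) + 184 * α * n
        ≡⟨ collect n α ⟩
      188 * α * n ∎
      where
      open ≤-Reasoning
      collect : ∀ n α → n * (4 * α) + 184 * α * n ≡ 188 * α * n
      collect = solve-∀
      pointwise : ∀ {ℓ x} → ℓ < n →
        χ (gap? α x ℓ) ≤ χ (ℓ <? 4 * α) + ∑ n (λ i → χ (class? α (2 ^ i) x ℓ))
      pointwise {ℓ} {x} ℓ<n with ℓ <? 4 * α
      ... | yes _ = ≤-trans (χ≤1 (gap? α x ℓ)) (m≤m+n 1 _)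
      ... | no  ≮ = χ≤ (gap? α x ℓ) λ gap →
        let i , i<n , class = gap⇒class ℓ<n (≮⇒≥ ≮) gap in
        ≤-trans (χ≥1 (class? α (2 ^ i) x ℓ) class) (∑-term (λ i → χ (class? α (2 ^ i) x ℓ)) i<n)

  -- Counting starts by their gaps

  -- Unfolded, this is the sum over `1 ≤ j ≤ J` of `2 ^ (J - j)` times the indicator of
  -- `Gap (2 ^ j) y ℓ`: a division-free dyadic substitute for `2 ^ J * g / ℓ`, where `g` is the
  -- length of the gap after `y`.
  gapWeight : ℕ → ℕ → ℕ → ℕ
  gapWeight zero    ℓ y = 0
  gapWeight (suc J) ℓ y = 2 * gapWeight J ℓ y + χ (gap? (2 ^ suc J) y ℓ)

  -- Level `j` has weight `2 ^ (J - j)` and at most `188 * 2 ^ j * n` gaps, so all `J` levels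
  -- contribute equally; this is the source of the logarithmic factor.
  ∑-gapWeight : ∀ J n → ∑ n (λ ℓ → ∑ n (gapWeight J ℓ)) ≤ 188 * n * J * 2 ^ J
  ∑-gapWeight zero    n = ≤-trans
    (∑-bounded n 0 (λ _ _ → ≤-reflexive (∑-zero n))) (≤-trans (≤-reflexive (*-zeroʳ n)) z≤n)
  ∑-gapWeight (suc J) n = begin
    ∑ n (λ ℓ → ∑ n (λ y → 2 * gapWeight J ℓ y + χ (gap? (2 ^ suc J) y ℓ)))
      ≡⟨ ∑-cong n (λ ℓ _ → trans (∑-distrib-+ n _ _)
           (cong (_+ ∑ n (λ y → χ (gap? (2 ^ suc J) y ℓ))) (sym (*-distribˡ-∑ 2 n _)))) ⟩
    ∑ n (λ ℓ → 2 * ∑ n (gapWeight J ℓ) + ∑ n (λ y → χ (gap? (2 ^ suc J) y ℓ)))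
      ≡⟨ trans (∑-distrib-+ n _ _)
           (cong (_+ ∑ n (λ ℓ → ∑ n (λ y → χ (gap? (2 ^ suc J) y ℓ)))) (sym (*-distribˡ-∑ 2 n _))) ⟩
    2 * ∑ n (λ ℓ → ∑ n (gapWeight J ℓ)) + ∑ n (λ ℓ → ∑ n (λ y → χ (gap? (2 ^ suc J) y ℓ)))
      ≤⟨ 2 ⊠ ∑-gapWeight J n ⊞ ∑-gaps n (1≤2^ (suc J)) ⟩
    2 * (188 * n * J * 2 ^ J) + 188 * (2 * 2 ^ J) * n
      ≡⟨ collect n J (2 ^ J) ⟩
    188 * n * suc J * (2 * 2 ^ J) ∎
    where
    open ≤-Reasoning
    collect : ∀ n J w → 2 * (188 * n * J * w) + 188 * (2 * w) * n ≡ 188 * n * suc J * (2 * w)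
    collect = solve-∀

  -- Short gaps are covered by the error term `ℓ`. For longer ones, doubling the inductive bound
  -- doubles the error, but the indicator of the new level is 1 and pays for the excess.
  gapWeight-lower : ∀ J {y ℓ} g → t y ≢ t (y + ℓ) → Agree ℓ (suc y) (suc y + g) → g ≤ ℓ →
    2 ^ J * g ≤ ℓ + 2 * ℓ * gapWeight J ℓ y
  gapWeight-lower zero    {ℓ = ℓ} g y≢ agr g≤ℓ =
    ≤-trans (≤-reflexive (*-identityˡ g)) (≤-trans g≤ℓ (m≤m+n ℓ _))
  gapWeight-lower (suc J) {y} {ℓ} g y≢ agr g≤ℓ with 2 ^ suc J * g ≤? ℓ
  ... | yes small = ≤-trans small (m≤m+n ℓ _)
  ... | no  large = linear (ℓ * c)
    (2 ⊠ gapWeight-lower J g y≢ agr g≤ℓ ⊞ ℓ ⊠ χ≥1 (gap? (2 ^ suc J) y ℓ) gap)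
    (identity (2 ^ J) g ℓ (gapWeight J ℓ y) c)
    where
    c = χ (gap? (2 ^ suc J) y ℓ)
    gap : Gap (2 ^ suc J) y ℓ
    gap = y≢ , λ o _ _ αo<ℓ → agr (suc y + o) (m≤m+n (suc y) o)
      (+-monoʳ-< (suc y) (*-cancelˡ-< (2 ^ suc J) o g (<-trans αo<ℓ (≰⇒> large))))
    identity : ∀ w g ℓ f c →
      2 * w * g + (2 * (ℓ + 2 * ℓ * f) + ℓ * c) + ℓ * c ≡
      ℓ + 2 * ℓ * (2 * f + c) + (2 * (w * g) + ℓ * 1)
    identity = solve-∀

  δ : ℕ → ℕ → ℕ
  δ ℓ i = χ (¬? (t i ≟ t (i + ℓ)))

  mismatches : ℕ → ℕ → ℕ
  mismatches ℓ b = ∑-from b ℓ (δ ℓ)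

  -- Scanning a window: y is the last disagreement seen, v = y + 1 + g the next position to
  -- inspect, and h positions remain.
  scan : ∀ J ℓ h g y v → v ≡ suc y + g → t y ≢ t (y + ℓ) → Agree ℓ (suc y) v → suc g + h ≤ ℓ →
    2 ^ J * (suc g + h) ≤
    (2 ^ J + ℓ) * (1 + ∑-from v h (δ ℓ)) + 2 * ℓ * (gapWeight J ℓ y + ∑-from v h (gapWeight J ℓ))
  scan J ℓ zero g y v refl y≢ agr fits =
    linear 0 (gapWeight-lower J g y≢ agr (≤-trans (n≤1+n g) (≤-trans (m≤m+n (suc g) 0) fits)))
      (identity (2 ^ J) ℓ g (gapWeight J ℓ y))
    where
    identity : ∀ w ℓ g f →
      w * (suc g + 0) + (ℓ + 2 * ℓ * f) + 0 ≡ (w + ℓ) * (1 + 0) + 2 * ℓ * (f + 0) + w * g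
    identity = solve-∀
  scan J ℓ (suc h) g y v v≡ y≢ agr fits
    rewrite ∑-from-suc v h (δ ℓ) | ∑-from-suc v h (gapWeight J ℓ) with t v ≟ t (v + ℓ)
  -- An agreement lengthens the current gap; the weight at `v` is left as slack.
  ... | yes eq = linear (2 * ℓ * gapWeight J ℓ v)
    (scan J ℓ h (suc g) y (suc v) (trans (cong suc v≡) (sym (+-suc (suc y) g))) y≢ agr′
      (subst (_≤ ℓ) (+-suc (suc g) h) fits))
    (identity (2 ^ J) ℓ g h _ (gapWeight J ℓ y) (gapWeight J ℓ v) _)
    where
    agr′ : Agree ℓ (suc y) (suc v)
    agr′ i y<i i≤v with m≤n⇒m<n∨m≡n (s≤s⁻¹ i≤v)
    ... | inj₁ i<v  = agr i y<i i<v
    ... | inj₂ refl = eq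
    identity : ∀ w ℓ g h D f f′ F →
      w * (suc g + suc h) + ((w + ℓ) * (1 + D) + 2 * ℓ * (f + F)) + 2 * ℓ * f′ ≡
      (w + ℓ) * (1 + (0 + D)) + 2 * ℓ * (f + (f′ + F)) + w * (suc (suc g) + h)
    identity = solve-∀
  -- A disagreement closes the gap after `y` and opens an empty one after `v`. Its cost is `2 ^ J`
  -- for the position `y` itself and `ℓ` for the error in `gapWeight-lower`.
  ... | no neq = linear 0
    (gapWeight-lower J g y≢ (subst (Agree ℓ (suc y)) v≡ agr)
        (≤-trans (n≤1+n g) (≤-trans (m≤m+n (suc g) (suc h)) fits))
     ⊞ scan J ℓ h 0 v (suc v) (cong suc (sym (+-identityʳ v))) neq
        (λ i v<i i≤v → ⊥-elim (<⇒≱ v<i (s≤s⁻¹ i≤v)))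
        (≤-trans (m≤n+m (suc h) (suc g)) fits))
    (identity (2 ^ J) ℓ g h _ (gapWeight J ℓ y) (gapWeight J ℓ v) _)
    where
    identity : ∀ w ℓ g h D f f′ F →
      w * (suc g + suc h) + (ℓ + 2 * ℓ * f + ((w + ℓ) * (1 + D) + 2 * ℓ * (f′ + F))) + 0 ≡
      (w + ℓ) * (1 + (1 + D)) + 2 * ℓ * (f + (f′ + F)) + (w * g + w * (1 + h))
    identity = solve-∀

  Start : ℕ → ℕ → ℕ → Set
  Start κ ℓ b = t b ≢ t (b + ℓ) × mismatches ℓ b ≤ κ

  start? : ∀ κ ℓ b → Dec (Start κ ℓ b)
  start? κ ℓ b = ¬? (t b ≟ t (b + ℓ)) ×-dec (mismatches ℓ b ≤? κ)

  start-weight : ∀ J {κ ℓ b} → Start κ ℓ b →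
    2 ^ J * ℓ ≤ (2 ^ J + ℓ) * κ + 2 * ℓ * ∑-from b ℓ (gapWeight J ℓ)
  start-weight J {κ} {zero}  {b} (y≢ , _) = ⊥-elim (y≢ (cong t (sym (+-identityʳ b))))
  start-weight J {κ} {suc h} {b} (y≢ , few) = begin
    2 ^ J * suc h
      ≤⟨ scan J (suc h) h 0 b (suc b) (cong suc (sym (+-identityʳ b))) y≢
           (λ i b<i i≤b → ⊥-elim (<⇒≱ b<i (s≤s⁻¹ i≤b))) ≤-refl ⟩
    (2 ^ J + suc h) * (1 + ∑-from (suc b) h (δ (suc h))) +
    2 * suc h * (gapWeight J (suc h) b + ∑-from (suc b) h (gapWeight J (suc h)))
      ≤⟨ +-monoˡ-≤ _ (*-monoʳ-≤ (2 ^ J + suc h) (begin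
           1 + ∑-from (suc b) h (δ (suc h))
             ≤⟨ +-monoˡ-≤ _ (χ≥1 (¬? (t b ≟ t (b + suc h))) y≢) ⟩
           δ (suc h) b + ∑-from (suc b) h (δ (suc h))
             ≡⟨ sym (∑-from-suc b h (δ (suc h))) ⟩
           mismatches (suc h) b
             ≤⟨ few ⟩
           κ ∎)) ⟩
    (2 ^ J + suc h) * κ +
    2 * suc h * (gapWeight J (suc h) b + ∑-from (suc b) h (gapWeight J (suc h)))
      ≡⟨ cong (λ S → (2 ^ J + suc h) * κ + 2 * suc h * S) (sym (∑-from-suc b h (gapWeight J (suc h)))) ⟩
    (2 ^ J + suc h) * κ + 2 * suc h * ∑-from b (suc h) (gapWeight J (suc h)) ∎
    where open ≤-Reasoning

  -- Both `2 ^ J * κ` and `ℓ * κ` are at most a quarter of `2 ^ J * ℓ`, so half of it remains for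
  -- the gaps.
  start-heavy : ∀ J {κ ℓ b} → 1 ≤ κ → 4 * κ ≤ 2 ^ J → 4 * κ ≤ ℓ → Start κ ℓ b →
    2 ^ J ≤ 4 * ∑-from b ℓ (gapWeight J ℓ)
  start-heavy J {κ} {ℓ} {b} 1≤κ 4κ≤w 4κ≤ℓ start =
    *-cancelˡ-≤ (2 * ℓ) {{>-nonZero (≤-trans 1≤κ (≤-trans (m≤m+n κ _) (≤-trans 4κ≤ℓ (m≤m+n ℓ _))))}}
      (linear 0 (4 ⊠ start-weight J start ⊞ 2 ^ J ⊠ 4κ≤ℓ ⊞ ℓ ⊠ 4κ≤w)
        (identity (2 ^ J) ℓ κ (∑-from b ℓ (gapWeight J ℓ))))
    where
    identity : ∀ w ℓ κ S →
      2 * ℓ * w + (4 * ((w + ℓ) * κ + 2 * ℓ * S) + (w * ℓ + ℓ * w)) + 0 ≡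
      2 * ℓ * (4 * S) + (4 * (w * ℓ) + (w * (4 * κ) + ℓ * (4 * κ)))
    identity = solve-∀

  StartCovering : ℕ → ℕ → ℕ → ℕ → Set
  StartCovering κ ℓ y b = Start κ ℓ b × b ≤ y × y < b + ℓ

  startCovering? : ∀ κ ℓ y b → Dec (StartCovering κ ℓ y b)
  startCovering? κ ℓ y b = start? κ ℓ b ×-dec (b ≤? y) ×-dec (y <? b + ℓ)

  -- The windows containing y all start inside the window of the leftmost one.
  ∑-startCovering : ∀ n κ ℓ y → ∑ n (λ b → χ (startCovering? κ ℓ y b)) ≤ κ
  ∑-startCovering n κ ℓ y = ∑-by-first n _ κ λ m b pos →
    let (_ , few) , _ , y<b+ℓ = χ-holds {P? = startCovering? κ ℓ y b} pos in
    ≤-trans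
      (∑-truncate m ℓ
        (λ o _ → χ≤ (startCovering? κ ℓ y (b + o))
          (λ ((y≢ , _) , _) → χ≥1 (¬? (t (b + o) ≟ t (b + o + ℓ))) y≢))
        (λ o pos′ → let _ , b+o≤y , _ = χ-holds {P? = startCovering? κ ℓ y (b + o)} pos′ in
          +-cancelˡ-< b o ℓ (≤-<-trans b+o≤y y<b+ℓ)))
      few

  -- Starts with `ℓ < 4 * κ` are counted trivially. Any other has gap weight at least `2 ^ J / 4` in
  -- its window, and each gap lies in at most `κ` windows of the same `ℓ`; the factor `2 ^ J`
  -- cancels against `∑-gapWeight`.
  ∑-starts : ∀ n J {κ} → 1 ≤ κ → 4 * κ ≤ 2 ^ J →
    ∑ n (λ ℓ → ∑ n (λ b → χ (start? κ ℓ b))) ≤ 4 * κ * n + 1504 * κ * n * J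
  ∑-starts n J {κ} 1≤κ 4κ≤w = *-cancelˡ-≤ w {{>-nonZero (1≤2^ J)}} (begin
    w * ∑ n (λ ℓ → ∑ n (λ b → χ (start? κ ℓ b)))
      ≡⟨ *-distribˡ-∑ w n _ ⟩
    ∑ n (λ ℓ → w * ∑ n (λ b → χ (start? κ ℓ b)))
      ≤⟨ ∑-mono n (λ ℓ ℓ<n → column ℓ<n) ⟩
    ∑ n (λ ℓ → n * w * χ (ℓ <? 4 * κ) + 4 * κ * ∑ (2 * n) (gapWeight J ℓ))
      ≡⟨ trans (∑-distrib-+ n _ _)
           (cong₂ _+_ (sym (*-distribˡ-∑ (n * w) n _)) (sym (*-distribˡ-∑ (4 * κ) n _))) ⟩
    n * w * ∑ n (λ ℓ → χ (ℓ <? 4 * κ)) + 4 * κ * ∑ n (λ ℓ → ∑ (2 * n) (gapWeight J ℓ))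
      ≤⟨ *-monoʳ-≤ (n * w) (∑-initial n (4 * κ))
         ⊞ *-monoʳ-≤ (4 * κ) (≤-trans (∑-interval 0 n _ (m≤m+n n _)) (∑-gapWeight J (2 * n))) ⟩
    n * w * (4 * κ) + 4 * κ * (188 * (2 * n) * J * w)
      ≡⟨ collect n w κ J ⟩
    w * (4 * κ * n + 1504 * κ * n * J) ∎)
    where
    open ≤-Reasoning
    w = 2 ^ J

    collect : ∀ n w κ J →
      n * w * (4 * κ) + 4 * κ * (188 * (2 * n) * J * w) ≡ w * (4 * κ * n + 1504 * κ * n * J)
    collect = solve-∀

    covered : ℕ → ℕ → ℕ → ℕ
    covered ℓ b y = χ (startCovering? κ ℓ y b) * gapWeight J ℓ y

    pointwise : ∀ {ℓ b} → ℓ < n → b < n →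
      w * χ (start? κ ℓ b) ≤ w * χ (ℓ <? 4 * κ) + 4 * ∑ (2 * n) (covered ℓ b)
    pointwise {ℓ} {b} ℓ<n b<n with ℓ <? 4 * κ
    ... | yes _ = ≤-trans (*-monoʳ-≤ w (χ≤1 (start? κ ℓ b))) (m≤m+n (w * 1) _)
    ... | no  ≮ = *χ≤ w (start? κ ℓ b) λ start → begin
      w
        ≤⟨ start-heavy J 1≤κ 4κ≤w (≮⇒≥ ≮) start ⟩
      4 * ∑-from b ℓ (gapWeight J ℓ)
        ≤⟨ *-monoʳ-≤ 4 (∑-mono ℓ (λ o o<ℓ → begin
             gapWeight J ℓ (b + o)
               ≡⟨ sym (*-identityˡ _) ⟩
             1 * gapWeight J ℓ (b + o)
               ≤⟨ *-monoˡ-≤ (gapWeight J ℓ (b + o)) (χ≥1 (startCovering? κ ℓ (b + o) b)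
                    (start , m≤m+n b o , +-monoʳ-< b o<ℓ)) ⟩
             covered ℓ b (b + o) ∎)) ⟩
      4 * ∑-from b ℓ (covered ℓ b)
        ≤⟨ *-monoʳ-≤ 4 (∑-interval b ℓ {2 * n} (covered ℓ b)
             (linear 2 (b<n ⊞ ℓ<n) (solve (b ∷ ℓ ∷ n ∷ [])))) ⟩
      4 * ∑ (2 * n) (covered ℓ b)
        ≤⟨ m≤n+m _ (w * 0) ⟩
      w * 0 + 4 * ∑ (2 * n) (covered ℓ b) ∎

    column : ∀ {ℓ} → ℓ < n → w * ∑ n (λ b → χ (start? κ ℓ b)) ≤
      n * w * χ (ℓ <? 4 * κ) + 4 * κ * ∑ (2 * n) (gapWeight J ℓ)
    column {ℓ} ℓ<n = begin
      w * ∑ n (λ b → χ (start? κ ℓ b))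
        ≡⟨ *-distribˡ-∑ w n _ ⟩
      ∑ n (λ b → w * χ (start? κ ℓ b))
        ≤⟨ ∑-mono n (λ b b<n → pointwise ℓ<n b<n) ⟩
      ∑ n (λ b → w * χ (ℓ <? 4 * κ) + 4 * ∑ (2 * n) (covered ℓ b))
        ≡⟨ ∑-distrib-+ n _ _ ⟩
      ∑ n (λ b → w * χ (ℓ <? 4 * κ)) + ∑ n (λ b → 4 * ∑ (2 * n) (covered ℓ b))
        ≤⟨ ∑-bounded n (w * χ (ℓ <? 4 * κ)) (λ _ _ → ≤-refl)
           ⊞ ≤-reflexive (trans (sym (*-distribˡ-∑ 4 n _)) (cong (4 *_) (∑-swap n (2 * n) _))) ⟩
      n * (w * χ (ℓ <? 4 * κ)) + 4 * ∑ (2 * n) (λ y → ∑ n (λ b → covered ℓ b y))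
        ≤⟨ ≤-reflexive (sym (*-assoc n w _))
           ⊞ *-monoʳ-≤ 4 (∑-mono (2 * n) (λ y _ → ≤-trans
               (≤-reflexive (sym (*-distribʳ-∑ (gapWeight J ℓ y) n _)))
               (*-monoˡ-≤ (gapWeight J ℓ y) (∑-startCovering n κ ℓ y)))) ⟩
      n * w * χ (ℓ <? 4 * κ) + 4 * ∑ (2 * n) (λ y → κ * gapWeight J ℓ y)
        ≡⟨ cong (n * w * χ (ℓ <? 4 * κ) +_)
             (trans (cong (4 *_) (sym (*-distribˡ-∑ κ (2 * n) _))) (sym (*-assoc 4 κ _))) ⟩
      n * w * χ (ℓ <? 4 * κ) + 4 * κ * ∑ (2 * n) (gapWeight J ℓ) ∎

-- Runs of a string

-- Zero-based; positions past the end read as `nothing`, which turns the string into a total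
-- function as `Word` expects.
at : {A : Set} → List A → ℕ → Maybe A
at []       i       = nothing
at (x ∷ xs) zero    = just x
at (x ∷ xs) (suc i) = at xs i

at-drop : ∀ {A : Set} i (xs : List A) o → at (drop i xs) o ≡ at xs (i + o)
at-drop zero    xs       o = refl
at-drop (suc i) []       o = refl
at-drop (suc i) (x ∷ xs) o = at-drop i xs o

at-take : ∀ {A : Set} {m o} (xs : List A) → o < m → at (take m xs) o ≡ at xs o
at-take {m = suc m}             []       o<m       = refl
at-take {m = suc m} {o = zero}  (x ∷ xs) o<m       = refl
at-take {m = suc m} {o = suc o} (x ∷ xs) (s≤s o<m) = at-take xs o<m

at-++ˡ : ∀ {A : Set} {o} (xs ys : List A) → o < length xs → at (xs ++ ys) o ≡ at xs o
at-++ˡ {o = zero}  (x ∷ xs) ys o<       = refl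
at-++ˡ {o = suc o} (x ∷ xs) ys (s≤s o<) = at-++ˡ xs ys o<

at-++ʳ : ∀ {A : Set} o (xs ys : List A) → at (xs ++ ys) (length xs + o) ≡ at ys o
at-++ʳ o []       ys = refl
at-++ʳ o (x ∷ xs) ys = at-++ʳ o xs ys

length-take-drop : ∀ {A : Set} i m (xs : List A) → i + m ≤ length xs → length (take m (drop i xs)) ≡ m
length-take-drop i m xs inside = trans (length-take m (drop i xs))
  (m≤n⇒m⊓n≡m (subst (m ≤_) (sym (length-drop i xs))
    (m+n≤o⇒m≤o∸n m (subst (_≤ length xs) (+-comm i m) inside))))

module Runs {A : Set} (_≟_ : DecidableEquality A) (k : ℕ) (T : List A) where

  _≟ᴹ_ : DecidableEquality (Maybe A)
  _≟ᴹ_ = ≡-dec _≟_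

  open Word _≟ᴹ_ (at T)

  dH≡∑ : ∀ X Y → length X ≡ length Y →
    dH _≟_ X Y ≡ ∑ (length X) (λ o → χ (¬? (at X o ≟ᴹ at Y o)))
  dH≡∑ []       []       eq = refl
  dH≡∑ (x ∷ xs) (y ∷ ys) eq with x ≟ y
  ... | yes _ = dH≡∑ xs ys (suc-injective eq)
  ... | no  _ = cong suc (dH≡∑ xs ys (suc-injective eq))

  dH≡mismatches : ∀ i ℓ X Y → i + 2 * ℓ ≤ length T → take (2 * ℓ) (drop i T) ≡ X ++ Y →
    length X ≡ length Y → dH _≟_ X Y ≡ mismatches ℓ i
  dH≡mismatches i ℓ X Y inside eq same = trans (dH≡∑ X Y same) (trans
    (cong (λ m → ∑ m (λ o → χ (¬? (at X o ≟ᴹ at Y o)))) length-X)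
    (∑-cong ℓ (λ o o<ℓ → cong₂ (λ u v → χ (¬? (u ≟ᴹ v))) (at-X o o<ℓ) (at-Y o o<ℓ))))
    where
    open ≡-Reasoning
    double : ∀ m → m + m ≡ 2 * m
    double = solve-∀

    length-X : length X ≡ ℓ
    length-X = *-cancelˡ-≡ (length X) ℓ 2 (begin
      2 * length X                 ≡⟨ sym (double (length X)) ⟩
      length X + length X          ≡⟨ cong (length X +_) same ⟩
      length X + length Y          ≡⟨ sym (length-++ X) ⟩
      length (X ++ Y)              ≡⟨ cong length (sym eq) ⟩
      length (take (2 * ℓ) (drop i T))  ≡⟨ length-take-drop i (2 * ℓ) T inside ⟩
      2 * ℓ                        ∎)

    at-XY : ∀ o → o < 2 * ℓ → at (X ++ Y) o ≡ at T (i + o)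
    at-XY o o< = trans (cong (λ Z → at Z o) (sym eq)) (trans (at-take (drop i T) o<) (at-drop i T o))

    at-X : ∀ o → o < ℓ → at X o ≡ at T (i + o)
    at-X o o<ℓ = trans (sym (at-++ˡ X Y (subst (o <_) (sym length-X) o<ℓ)))
      (at-XY o (≤-trans o<ℓ (m≤m+n ℓ _)))

    at-Y : ∀ o → o < ℓ → at Y o ≡ at T (i + o + ℓ)
    at-Y o o<ℓ = begin
      at Y o                       ≡⟨ sym (at-++ʳ o X Y) ⟩
      at (X ++ Y) (length X + o)   ≡⟨ cong (λ m → at (X ++ Y) (m + o)) length-X ⟩
      at (X ++ Y) (ℓ + o)          ≡⟨ at-XY (ℓ + o) (subst (ℓ + o <_) (double ℓ) (+-monoʳ-< ℓ o<ℓ)) ⟩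
      at T (i + (ℓ + o))           ≡⟨ cong (at T) (rotate i ℓ o) ⟩
      at T (i + o + ℓ)             ∎
      where
      rotate : ∀ i ℓ o → i + (ℓ + o) ≡ i + o + ℓ
      rotate = solve-∀

  sub≡take : ∀ i ℓ → sub T (suc i) (suc i + 2 * ℓ) ≡ take (2 * ℓ) (drop i T)
  sub≡take i ℓ = cong (λ m → take m (drop i T)) (m+n∸m≡n (suc i) (2 * ℓ))

  square⇒mismatches : ∀ i ℓ → i + 2 * ℓ ≤ length T →
    IsKSquare _≟_ k (sub T (suc i) (suc i + 2 * ℓ)) → mismatches ℓ i ≤ k
  square⇒mismatches i ℓ inside (X , Y , eq , same , few) =
    subst (_≤ k) (dH≡mismatches i ℓ X Y inside (trans (sym (sub≡take i ℓ)) eq) same) few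

  mismatches⇒square : ∀ i ℓ → i + 2 * ℓ ≤ length T →
    mismatches ℓ i ≤ k → IsKSquare _≟_ k (sub T (suc i) (suc i + 2 * ℓ))
  mismatches⇒square i ℓ inside few =
    X , Y , trans (sub≡take i ℓ) S≡X++Y , same ,
    subst (_≤ k) (sym (dH≡mismatches i ℓ X Y inside S≡X++Y same)) few
    where
    open ≡-Reasoning
    S = take (2 * ℓ) (drop i T)
    X = take ℓ S
    Y = drop ℓ S
    S≡X++Y : S ≡ X ++ Y
    S≡X++Y = sym (take++drop≡id ℓ S)
    length-S : length S ≡ 2 * ℓ
    length-S = length-take-drop i (2 * ℓ) T inside
    same : length X ≡ length Y
    same = begin
      length X      ≡⟨ length-take ℓ S ⟩
      ℓ ⊓ length S  ≡⟨ m≤n⇒m⊓n≡m (subst (ℓ ≤_) (sym length-S) (m≤m+n ℓ _)) ⟩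
      ℓ             ≡⟨ sym (+-identityʳ ℓ) ⟩
      ℓ + 0         ≡⟨ sym (m+n∸m≡n ℓ (ℓ + 0)) ⟩
      2 * ℓ ∸ ℓ     ≡⟨ cong (_∸ ℓ) (sym length-S) ⟩
      length S ∸ ℓ  ≡⟨ sym (length-drop ℓ S) ⟩
      length Y      ∎

  -- From runs to starts.

  mismatches-slide : ∀ ℓ b → mismatches ℓ b + δ ℓ (b + ℓ) ≡ δ ℓ b + mismatches ℓ (suc b)
  mismatches-slide ℓ b = trans (sym (∑-last ℓ (λ o → δ ℓ (b + o)))) (∑-from-suc b ℓ (δ ℓ))

  -- The one-based left end `suc (suc b)` is position `suc b` here. By maximality the window at `b`
  -- has more than `k` mismatches, while the one at `suc b` has at most `k`; sliding by one position
  -- drops only `b` and adds only `b + ℓ`.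
  run⇒start : ∀ {b c ℓ} → IsKRun _≟_ k T (suc (suc b) , c , ℓ) → Start (suc k) ℓ b
  run⇒start {b} {c} {ℓ} ((_ , c≤ , 1≤ℓ , fits , squares) , maximal) =
    disagree , ≤-trans (m≤m+n _ _) (≤-trans (≤-reflexive (mismatches-slide ℓ b))
      (χ≤1 (¬? (at T b ≟ᴹ at T (b + ℓ))) ⊞ few))
    where
    inside : suc b + 2 * ℓ ≤ length T
    inside = s≤s⁻¹ (≤-trans fits c≤)

    few : mismatches ℓ (suc b) ≤ k
    few = square⇒mismatches (suc b) ℓ inside (squares (suc (suc b)) ≤-refl fits)

    many : ¬ mismatches ℓ b ≤ k
    many small with proj₁ (maximal (suc b) c (n≤1+n (suc b)) ≤-refl
      (s≤s z≤n , c≤ , 1≤ℓ , ≤-trans (n≤1+n _) fits , squares′))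
      where
      squares′ : ∀ i → suc b ≤ i → i + 2 * ℓ ≤ c → IsKSquare _≟_ k (sub T i (i + 2 * ℓ))
      squares′ i b<i end with m≤n⇒m<n∨m≡n b<i
      ... | inj₁ 1+b<i = squares i 1+b<i end
      ... | inj₂ refl  = mismatches⇒square b ℓ (≤-trans (n≤1+n _) inside) small
    ... | ()

    disagree : at T b ≢ at T (b + ℓ)
    disagree eq = many (begin
      mismatches ℓ b                        ≤⟨ m≤m+n _ _ ⟩
      mismatches ℓ b + δ ℓ (b + ℓ)          ≡⟨ mismatches-slide ℓ b ⟩
      δ ℓ b + mismatches ℓ (suc b)          ≤⟨ χ≤ (¬? (at T b ≟ᴹ at T (b + ℓ))) (λ ≢ → ⊥-elim (≢ eq)) ⊞ few ⟩
      0 + k                                 ∎)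
      where open ≤-Reasoning

  key : ℕ × ℕ × ℕ → ℕ × ℕ
  key (a , _ , ℓ) = a ∸ 1 , ℓ

  -- Of two runs with the same left end and period, the one ending first would be extended by the
  -- other, so maximality determines the right end.
  key-injective : ∀ {r s} → IsKRun _≟_ k T r → IsKRun _≟_ k T s → key r ≡ key s → r ≡ s
  key-injective {suc a , b , ℓ} {suc _ , b′ , _} (range , maximal) (range′ , maximal′) refl
    with ≤-total b b′
  ... | inj₁ b≤b′ = cong (λ c → suc a , c , ℓ) (sym (proj₂ (maximal (suc a) b′ ≤-refl b≤b′ range′)))
  ... | inj₂ b′≤b = cong (λ c → suc a , c , ℓ) (proj₂ (maximal′ (suc a) b ≤-refl b′≤b range))
  key-injective {zero , _}          ((() , _) , _)
  key-injective {suc _ , _} {zero , _} _ ((() , _) , _)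

  -- A run at the first position has no preceding disagreement; the value 1 allows one such run for
  -- each period.
  startAt : ℕ → ℕ → ℕ
  startAt zero    ℓ = 1
  startAt (suc b) ℓ = χ (start? (suc k) ℓ b)

  Counted : ℕ × ℕ → Set
  Counted (a , ℓ) = a < suc (length T) × ℓ < length T × 1 ≤ startAt a ℓ

  key-counted : ∀ {r} → IsKRun _≟_ k T r → Counted (key r)
  key-counted {suc a , c , ℓ} run@((_ , c≤ , 1≤ℓ , fits , _) , _) =
    s≤s (≤-trans (m≤m+n a _) inside) ,
    linear a (inside ⊞ 1≤ℓ) (identity a ℓ (length T)) ,
    positive a run
    where
    inside : a + 2 * ℓ ≤ length T
    inside = s≤s⁻¹ (≤-trans fits c≤)
    identity : ∀ a ℓ n → suc ℓ + (n + ℓ) + a ≡ n + (a + 2 * ℓ + 1)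
    identity = solve-∀
    positive : ∀ a → IsKRun _≟_ k T (suc a , c , ℓ) → 1 ≤ startAt a ℓ
    positive zero    run = ≤-refl
    positive (suc b) run = χ≥1 (start? (suc k) ℓ b) (run⇒start run)

  unique-keys : ∀ {L} → Unique L → All (IsKRun _≟_ k T) L → Unique (map key L)
  unique-keys distinct runs = AllPairs.map⁺ (go distinct runs)
    where
    go : ∀ {L} → Unique L → All (IsKRun _≟_ k T) L → AllPairs (λ r s → key r ≢ key s) L
    go AllPairs.[]               All.[]           = AllPairs.[]
    go (r≢ AllPairs.∷ distinct) (run All.∷ runs) =
      All.zipWith (λ (r≢s , run′) eq → r≢s (key-injective run run′ eq)) (r≢ , runs)
      AllPairs.∷ go distinct runs

-- Counting a duplicate-free list of pairs.

multiplicity : List (ℕ × ℕ) → ℕ → ℕ → ℕ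
multiplicity []            u v = 0
multiplicity ((x , y) ∷ K) u v = χ ((x ≟ℕ u) ×-dec (y ≟ℕ v)) + multiplicity K u v

length≤∑-multiplicity : ∀ {m n} K → All (λ (x , y) → x < m × y < n) K →
  length K ≤ ∑ n (λ v → ∑ m (λ u → multiplicity K u v))
length≤∑-multiplicity []            _ = z≤n
length≤∑-multiplicity {m} {n} ((x , y) ∷ K) ((x<m , y<n) All.∷ bounds) = begin
  1 + length K
    ≤⟨ ≤-trans (χ≥1 ((x ≟ℕ x) ×-dec (y ≟ℕ y)) (refl , refl))
         (≤-trans (∑-term (λ u → hit u y) x<m) (∑-term (λ v → ∑ m (λ u → hit u v)) y<n))
       ⊞ length≤∑-multiplicity K bounds ⟩
  ∑ n (λ v → ∑ m (λ u → hit u v)) + ∑ n (λ v → ∑ m (λ u → multiplicity K u v))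
    ≡⟨ sym (∑-distrib-+ n _ _) ⟩
  ∑ n (λ v → ∑ m (λ u → hit u v) + ∑ m (λ u → multiplicity K u v))
    ≡⟨ ∑-cong n (λ v _ → sym (∑-distrib-+ m _ _)) ⟩
  ∑ n (λ v → ∑ m (λ u → multiplicity ((x , y) ∷ K) u v)) ∎
  where
  open ≤-Reasoning
  hit : ℕ → ℕ → ℕ
  hit u v = χ ((x ≟ℕ u) ×-dec (y ≟ℕ v))

multiplicity-absent : ∀ {u v} K → All ((u , v) ≢_) K → multiplicity K u v ≡ 0
multiplicity-absent []            _ = refl
multiplicity-absent {u} {v} ((x , y) ∷ K) (≢xy All.∷ absent) =
  cong₂ _+_ (n≤0⇒n≡0 (χ≤ ((x ≟ℕ u) ×-dec (y ≟ℕ v)) λ { (refl , refl) → ⊥-elim (≢xy refl) }))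
            (multiplicity-absent K absent)

multiplicity≤ : ∀ {h : ℕ → ℕ → ℕ} K → Unique K → All (λ (x , y) → 1 ≤ h x y) K →
  ∀ u v → multiplicity K u v ≤ h u v
multiplicity≤ []            _ _ u v = z≤n
multiplicity≤ ((x , y) ∷ K) (fresh AllPairs.∷ distinct) (pos All.∷ poss) u v with (x ≟ℕ u) ×-dec (y ≟ℕ v)
... | yes (refl , refl) rewrite multiplicity-absent K fresh = pos
... | no  _ = multiplicity≤ K distinct poss u v

unique-length≤∑ : ∀ {m n} {h : ℕ → ℕ → ℕ} K → Unique K →
  All (λ (x , y) → x < m × y < n × 1 ≤ h x y) K → length K ≤ ∑ n (λ v → ∑ m (λ u → h u v))
unique-length≤∑ {m} {n} K distinct all = ≤-trans
  (length≤∑-multiplicity K (All.map (λ (x<m , y<n , _) → x<m , y<n) all))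
  (∑-mono n (λ v _ → ∑-mono m (λ u _ →
    multiplicity≤ K distinct (All.map (λ (_ , _ , pos) → pos) all) u v)))

-- The final bound.

k<2^[1+⌊log₂k⌋] : ∀ k → k < 2 ^ (1 + ⌊log₂ k ⌋)
k<2^[1+⌊log₂k⌋] k with 2 ^ (1 + ⌊log₂ k ⌋) ≤? k
... | no  ≰ = ≰⇒> ≰
... | yes ≤k = ⊥-elim (<-irrefl refl
  (subst (_≤ ⌊log₂ k ⌋) (⌊log₂[2^n]⌋≡n (1 + ⌊log₂ k ⌋)) (⌊log₂⌋-mono-≤ ≤k)))

theorem1 : ∃[ C ] (∀ {A : Set} (_≟_ : DecidableEquality A) (k : ℕ) → 1 ≤ k →
    (T : List A) (L : List (ℕ × ℕ × ℕ)) → Unique L →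
    All (IsKRun _≟_ k T) L →
    length L ≤ C * length T * k * (1 + ⌊log₂ k ⌋))
-- The constant is the coefficient of `n` at `k = 1`, namely `1 + 4 * 2 + 1504 * 2 * 3`.
theorem1 = 9033 , bound
  where
  open ≤-Reasoning
  bound : ∀ {A : Set} (_≟_ : DecidableEquality A) (k : ℕ) → 1 ≤ k →
    (T : List A) (L : List (ℕ × ℕ × ℕ)) → Unique L → All (IsKRun _≟_ k T) L →
    length L ≤ 9033 * length T * k * (1 + ⌊log₂ k ⌋)
  bound _≟_ k@(suc j) _ T L distinct runs = begin
    length L
      ≡⟨ sym (length-map key L) ⟩
    length (map key L)
      ≤⟨ unique-length≤∑ {h = startAt} (map key L) (unique-keys distinct runs)
           (All.map⁺ (All.map key-counted runs)) ⟩
    ∑ n (λ ℓ → 1 + ∑ n (λ b → χ (start? (suc k) ℓ b)))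
      ≡⟨ ∑-distrib-+ n _ _ ⟩
    ∑ n (λ _ → 1) + ∑ n (λ ℓ → ∑ n (λ b → χ (start? (suc k) ℓ b)))
      ≤⟨ ≤-reflexive (∑-ones n) ⊞ ∑-starts n J (s≤s z≤n) 4κ≤2^J ⟩
    n + (4 * suc k * n + 1504 * suc k * n * J)
      -- The added term is the exact difference to the claimed bound, expanded in `j = k - 1` and
      -- `g`.
      ≤⟨ m≤m+n _ (4517 * n * j + 6025 * n * g + 7529 * n * j * g) ⟩
    n + (4 * suc k * n + 1504 * suc k * n * J) + (4517 * n * j + 6025 * n * g + 7529 * n * j * g)
      ≡⟨ collect n j g ⟩
    9033 * n * k * (1 + g) ∎
    where
    open Runs _≟_ k T
    open Word (≡-dec _≟_) (at T)
    n = length T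
    g = ⌊log₂ k ⌋
    -- Chosen so that `4 * (k + 1) ≤ 4 * 2 ^ (1 + g) = 2 ^ J`.
    J = 3 + g
    4κ≤2^J : 4 * suc k ≤ 2 ^ J
    4κ≤2^J = ≤-trans (*-monoʳ-≤ 4 (k<2^[1+⌊log₂k⌋] k)) (≤-reflexive (quadruple (2 ^ (1 + g))))
      where
      quadruple : ∀ w → 4 * w ≡ 2 * (2 * w)
      quadruple = solve-∀
    collect : ∀ n j g →
      n + (4 * suc (suc j) * n + 1504 * suc (suc j) * n * (3 + g)) +
        (4517 * n * j + 6025 * n * g + 7529 * n * j * g) ≡
      9033 * n * suc j * (1 + g)
    collect = solve-∀
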